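{- For every two projection games $G$ and $H$, $$\mathrm{val}_+(G\otimes H)=\mathrm{val}_+(G)\cdot\mathrm{val}_+(H).$$
   Context: Projection games. A projection game $G$ is given by finite vertex sets $U,V$, a finite alphabet $\Sigma$, and a finite nonnegatively weighted bipartite multigraph between $U$ and $V$ whose edges carry constraints $\pi\subseteq\Sigma\times\Sigma$ such that for every $\beta\in\Sigma$ there is at most one $\alpha\in\Sigma$ with $(\alpha,\beta)\in\pi$. Choosing an edge with probability proportional to its weight gives a distribution on triples $(u,v,\pi)$, whose marginals are the probability measures on $U$ and $V$ (every vertex is assumed to have positive measure); $(v,\pi)|u$ denotes the distribution conditioned on $u$. $G$ is identified with the operator $Gf(u,\alpha)=\mathbb{E}_{(v,\pi)|u}\sum_{\beta:(\alpha,\beta)\in\pi}f(v,\beta)$ from functions on $V\times\Sigma$ to functions on $U\times\Sigma$, where $\|g\|^2=\mathbb{E}_u\sum_\alpha g(u,\alpha)^2$ for $g:U\times\Sigma\to\mathbb{R}$. Products. For $G$ on $U,V,\Sigma$ and $H$ on $U',V',\Sigma'$, $G\otimes H$ is the projection game on $U\times U'$, $V\times V'$ with alphabet $\Sigma\times\Sigma'$: $(u,v,\pi)$ and $(u',v',\pi')$ are drawn independently from $G$ and $H$, the edge joins $(u,u')$ and $(v,v')$, and answers $(\alpha,\alpha'),(\beta,\beta')$ satisfy the constraint iff $(\alpha,\beta)\in\pi$ and $(\alpha',\beta')\in\pi'$. The relaxation $\mathrm{val}_+$. For a finite measure space $\Omega$ (finite set with a measure) and $f:V\times\Sigma\times\Omega\to\mathbb{R}$,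 write $f_\omega(v,\beta)=f(v,\beta,\omega)$. Let $\mathrm{Id}$ be the identity on $L(\Omega)$; then $\|(G\otimes\mathrm{Id})f\|^2=\int_\Omega\|Gf_\omega\|^2d\omega$. For $v\in V$ put $\|(T_v\otimes\mathrm{Id})f\|^2=\int_\Omega\big(\sum_\beta f(v,\beta,\omega)\big)^2d\omega$. Then $$\mathrm{val}_+(G)=\sup_\Omega\ \sup_{f\ge0}\frac{\|(G\otimes\mathrm{Id})f\|}{\max_{v\in V}\|(T_v\otimes\mathrm{Id})f\|},$$ the supremum being over finite measure spaces $\Omega$ and nonnegative $f$ with nonzero denominator; equivalently, it is the supremum of $\|(G\otimes\mathrm{Id})f\|$ over nonnegative $f$ with $\|(T_v\otimes\mathrm{Id})f\|\le1$ for all $v$. -}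

module Defs where

open import Level using (0ℓ) renaming (suc to lsuc)
open import Algebra.Bundles using (CommutativeRing)
open import Data.Bool.Base using (Bool; true; false; _∧_; if_then_else_)
open import Data.Fin.Base using (Fin; zero; suc)
import Data.Fin.Properties as Fin
open import Data.Nat.Base as ℕ using (ℕ)
open import Data.Product.Base using (∃; _×_; _,_; proj₁; proj₂)
open import Data.Product.Function.NonDependent.Propositional using (_×-↔_)
open import Data.Sum.Base using (_⊎_; inj₁; inj₂)
open import Data.Vec.Functional using (foldr)
open import Function.Base using (_∘_)
open import Function.Bundles using (_↔_; Inverse)
open import Function.Construct.Composition using (_↔-∘_)
open import Function.Properties.Inverse using (↔-sym; ↔⇒↣)
open import Relation.Binary.Bundles using (TotalOrder)
open import Relation.Binary.Core using (Rel)
open import Relation.Binary.Definitions using (DecidableEquality)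
import Relation.Binary.Construct.NonStrictToStrict as Strict
open import Relation.Binary.PropositionalEquality.Core as ≡ using (_≡_)
open import Relation.Binary.Structures using (IsDecTotalOrder)
open import Relation.Nullary using (¬_; yes; no; contradiction)
open import Relation.Nullary.Decidable using (via-injection; ⌊_⌋)
open import Relation.Unary using (Pred)

-- The real numbers, axiomatised as a Dedekind-complete ordered field. Any two
-- of these are isomorphic, so a statement about all of them is a statement
-- about ℝ. Equality is the setoid equality _≈_ of the underlying ring.
record CompleteOrderedField : Set₁ where
  field
    commutativeRing : CommutativeRing 0ℓ 0ℓ

  open CommutativeRing commutativeRing public

  field
    _≤_             : Rel Carrier 0ℓ
    isDecTotalOrder : IsDecTotalOrder _≈_ _≤_
    +-monoʳ-≤       : ∀ x {y z} → y ≤ z → (x + y) ≤ (x + z)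
    *-nonNeg        : ∀ {x y} → 0# ≤ x → 0# ≤ y → 0# ≤ (x * y)
    0≉1             : ¬ (0# ≈ 1#)
    inverse         : ∀ x → ¬ (x ≈ 0#) → ∃ λ y → x * y ≈ 1#

  UpperBound : Pred Carrier 0ℓ → Pred Carrier 0ℓ
  UpperBound P b = ∀ x → P x → x ≤ b

  IsSupremum : Pred Carrier 0ℓ → Pred Carrier 0ℓ
  IsSupremum P s = UpperBound P s × (∀ b → UpperBound P b → s ≤ b)

  field
    complete : ∀ P → ∃ P → ∃ (UpperBound P) → ∃ (IsSupremum P)

  infix 4 _≤_ _<_

  _<_ : Rel Carrier 0ℓ
  _<_ = Strict._<_ _≈_ _≤_

record FinSet : Set₁ where
  field
    Elem : Set
    size : ℕ
    enum : Elem ↔ Fin size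

  at : Fin size → Elem
  at = Inverse.from enum

  index : Elem → Fin size
  index = Inverse.to enum

  at-index : ∀ x → at (index x) ≡ x
  at-index x = Inverse.inverseʳ enum ≡.refl

  _≟_ : DecidableEquality Elem
  _≟_ = via-injection (↔⇒↣ enum) Fin._≟_

  eqᵇ : Elem → Elem → Bool
  eqᵇ x y = ⌊ x ≟ y ⌋

open FinSet using (Elem; size; at; index; at-index; eqᵇ)

infixr 2 _×ᶠ_

_×ᶠ_ : FinSet → FinSet → FinSet
X ×ᶠ Y = record
  { Elem = Elem X × Elem Y
  ; size = size X ℕ.* size Y
  ; enum = ↔-sym Fin.*↔× ↔-∘ (FinSet.enum X ×-↔ FinSet.enum Y)
  }

module Games (R : CompleteOrderedField) where

  open CompleteOrderedField R hiding (zero) renaming (Carrier to ℝ)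
  open IsDecTotalOrder isDecTotalOrder public using (_≤?_; isTotalOrder; total)
    renaming (refl to ≤-refl; trans to ≤-trans; antisym to ≤-antisym; reflexive to ≤-reflexive; _≟_ to _≈?_)

  ≤-totalOrder : TotalOrder 0ℓ 0ℓ 0ℓ
  ≤-totalOrder = record { isTotalOrder = isTotalOrder }

  open import Algebra.Construct.NaturalChoice.Max ≤-totalOrder public using (_⊔_; x≤x⊔y; x≤y⊔x)
  open import Algebra.Properties.Semiring.Sum semiring public using (sum; sum-cong-≋; ∑-comm; *-distribˡ-sum; *-distribʳ-sum)
  open import Algebra.Properties.Ring ring using (+-cancelˡ)
  open import Algebra.Solver.Ring.NaturalCoefficients.Default commutativeSemiring
    using (solve; _:=_; _:+_; _:*_)

  ≤-respˡ : ∀ {x y z} → x ≈ y → x ≤ z → y ≤ z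
  ≤-respˡ p q = ≤-trans (≤-reflexive (sym p)) q

  ≤-respʳ : ∀ {x y z} → x ≈ y → z ≤ x → z ≤ y
  ≤-respʳ p q = ≤-trans q (≤-reflexive p)

  +-mono-≤ : ∀ {w x y z} → w ≤ x → y ≤ z → w + y ≤ x + z
  +-mono-≤ {w} {x} {y} {z} p q =
    ≤-trans (+-monoʳ-≤ w q) (≤-respˡ (+-comm z w) (≤-respʳ (+-comm z x) (+-monoʳ-≤ z p)))

  +-nonNeg : ∀ {x y} → 0# ≤ x → 0# ≤ y → 0# ≤ x + y
  +-nonNeg p q = ≤-respˡ (+-identityˡ 0#) (+-mono-≤ p q)

  diff : ∀ {x y} → x ≤ y → ∃ λ d → (0# ≤ d) × (x + d ≈ y)
  diff {x} {y} p = (- x + y)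
    , ≤-respˡ (-‿inverseˡ x) (+-monoʳ-≤ (- x) p)
    , trans (sym (+-assoc _ _ _)) (trans (+-congʳ (-‿inverseʳ x)) (+-identityˡ y))

  ≤-by : ∀ {x d y} → 0# ≤ d → x + d ≈ y → x ≤ y
  ≤-by {x} p q = ≤-respʳ q (≤-respˡ (+-identityʳ x) (+-monoʳ-≤ x p))

  x≤x+d : ∀ {x d} → 0# ≤ d → x ≤ x + d
  x≤x+d p = ≤-by p refl

  x≤d+x : ∀ {x d} → 0# ≤ d → x ≤ d + x
  x≤d+x p = ≤-by p (+-comm _ _)

  +-cancelˡ-≤ : ∀ {x y z} → x + y ≤ x + z → y ≤ z
  +-cancelˡ-≤ {x} {y} {z} p with diff p
  ... | d , d≥0 , e = ≤-by d≥0 (+-cancelˡ x _ _ (trans (sym (+-assoc x y d)) e))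

  *-monoˡ-≤ : ∀ {x y z} → 0# ≤ z → x ≤ y → x * z ≤ y * z
  *-monoˡ-≤ {x} {y} {z} z≥0 p with diff p
  ... | d , d≥0 , e = ≤-by (*-nonNeg d≥0 z≥0) (trans (sym (distribʳ z x d)) (*-congʳ e))

  *-monoʳ-≤ : ∀ {x y z} → 0# ≤ z → x ≤ y → z * x ≤ z * y
  *-monoʳ-≤ z≥0 p = ≤-respˡ (*-comm _ _) (≤-respʳ (*-comm _ _) (*-monoˡ-≤ z≥0 p))

  ≰⇒> : ∀ {x y} → ¬ (x ≤ y) → y < x
  ≰⇒> {x} {y} n with total x y
  ... | inj₁ p = contradiction p n
  ... | inj₂ q = q , λ e → n (≤-reflexive (sym e))

  <⇒≱ : ∀ {x y} → x < y → ¬ (y ≤ x)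
  <⇒≱ (p , n) q = n (≤-antisym p q)

  square≥0 : ∀ x → 0# ≤ x * x
  square≥0 x with total 0# x
  ... | inj₁ p = *-nonNeg p p
  ... | inj₂ p with diff p
  ... | d , d≥0 , e = ≤-respʳ (+-cancelˡ (x * d) _ _ eq) (*-nonNeg d≥0 d≥0)
    where
    eq : x * d + d * d ≈ x * d + x * x
    eq = trans (sym (distribʳ d x d)) (trans (*-congʳ e) (trans (zeroˡ d)
           (trans (sym (zeroʳ x)) (trans (*-congˡ (trans (sym e) (+-comm x d))) (distribˡ x d x)))))

  0≤1 : 0# ≤ 1#
  0≤1 = ≤-respʳ (*-identityˡ 1#) (square≥0 1#)

  1≉0 : ¬ (1# ≈ 0#)
  1≉0 p = 0≉1 (sym p)

  *-≉0 : ∀ {x y} → ¬ (x ≈ 0#) → ¬ (y ≈ 0#) → ¬ (x * y ≈ 0#)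
  *-≉0 {x} {y} nx ny p with inverse x nx
  ... | z , xz = ny (trans (sym (*-identityˡ y)) (trans (*-congʳ (trans (sym xz) (*-comm x z)))
                   (trans (*-assoc z x y) (trans (*-congˡ p) (zeroʳ z)))))

  infixl 7 _/_[_]

  _/_[_] : ∀ (x y : ℝ) → ¬ (y ≈ 0#) → ℝ
  x / y [ y≉0 ] = x * proj₁ (inverse y y≉0)

  *-pos : ∀ {x y} → 0# < x → 0# < y → 0# < x * y
  *-pos (p , n) (q , m) = *-nonNeg p q , λ e → *-≉0 (n ∘ sym) (m ∘ sym) (sym e)

  pos-factorˡ : ∀ {x} y → 0# ≤ x → 0# < x * y → 0# < x
  pos-factorˡ y p (_ , n) = p , λ e → n (trans (sym (zeroˡ y)) (*-congʳ e))

  inverse-pos : ∀ {x} → 0# ≤ x → (n : ¬ (x ≈ 0#)) → 0# < proj₁ (inverse x n)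
  inverse-pos {x} p n with inverse x n
  ... | y , e with total 0# y
  ... | inj₁ q = q , λ z → 1≉0 (trans (sym e) (trans (*-congˡ (sym z)) (zeroʳ x)))
  ... | inj₂ q = contradiction
                   (≤-antisym (≤-respˡ e (≤-respʳ (zeroʳ x) (*-monoʳ-≤ p q))) 0≤1) 1≉0

  /-cancel : ∀ x {y} (n : ¬ (y ≈ 0#)) → x / y [ n ] * y ≈ x
  /-cancel x {y} n = trans (*-assoc _ _ _)
    (trans (*-congˡ (trans (*-comm _ y) (proj₂ (inverse y n)))) (*-identityʳ x))

  *-cancelʳ-≤ : ∀ {x y z} → 0# < z → x * z ≤ y * z → x ≤ y
  *-cancelʳ-≤ {x} {y} {z} (p , n) q = ≤-respˡ (c x) (≤-respʳ (c y) (*-monoˡ-≤ (proj₁ (inverse-pos p m)) q))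
    where
    m : ¬ (z ≈ 0#)
    m = n ∘ sym
    c : ∀ w → w * z * proj₁ (inverse z m) ≈ w
    c w = trans (*-assoc _ _ _) (trans (*-congˡ (proj₂ (inverse z m))) (*-identityʳ w))

  square-cancel-≤ : ∀ {x y} → 0# ≤ y → x * x ≤ y * y → x ≤ y
  square-cancel-≤ {x} {y} y≥0 p with total x y
  ... | inj₁ q = q
  ... | inj₂ q with diff q
  ... | d , d≥0 , e with d ≈? 0#
  ...   | yes d≈0 = ≤-reflexive (trans (sym e) (trans (+-congˡ d≈0) (+-identityʳ y)))
  ...   | no  d≉0 = contradiction (≤-antisym d²≤0 (square≥0 d)) (*-≉0 d≉0 d≉0)
    where
    expand : x * x ≈ y * y + (d * d + (y * d + y * d))
    expand = trans (*-cong (sym e) (sym e))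
      (solve 2 (λ y d → (y :+ d) :* (y :+ d) := y :* y :+ (d :* d :+ (y :* d :+ y :* d))) refl y d)
    yd≥0 : 0# ≤ y * d
    yd≥0 = *-nonNeg y≥0 d≥0
    d²≤0 : d * d ≤ 0#
    d²≤0 = ≤-trans (x≤x+d (+-nonNeg yd≥0 yd≥0))
      (+-cancelˡ-≤ (≤-respˡ expand (≤-respʳ (sym (+-identityʳ (y * y))) p)))

  square-mono-≤ : ∀ {x y} → 0# ≤ x → x ≤ y → x * x ≤ y * y
  square-mono-≤ p q = ≤-trans (*-monoˡ-≤ p q) (*-monoʳ-≤ (≤-trans p q) q)

  [x+y]²≤2[x²+y²] : ∀ x y → (x + y) * (x + y) ≤ (x * x + y * y) + (x * x + y * y)
  [x+y]²≤2[x²+y²] x y with total x y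
  [x+y]²≤2[x²+y²] x y | inj₁ q with diff q
  ... | d , _ , e = ≤-by (square≥0 d) (trans (+-congʳ (*-cong (+-congˡ (sym e)) (+-congˡ (sym e))))
      (trans (solve 2 (λ x d → (x :+ (x :+ d)) :* (x :+ (x :+ d)) :+ d :* d
               := (x :* x :+ (x :+ d) :* (x :+ d)) :+ (x :* x :+ (x :+ d) :* (x :+ d))) refl x d)
        (+-cong (+-congˡ (*-cong e e)) (+-congˡ (*-cong e e)))))
  [x+y]²≤2[x²+y²] x y | inj₂ q with diff q
  ... | d , _ , e = ≤-by (square≥0 d) (trans (+-congʳ (*-cong (+-congʳ (sym e)) (+-congʳ (sym e))))
      (trans (solve 2 (λ y d → ((y :+ d) :+ y) :* ((y :+ d) :+ y) :+ d :* d
               := ((y :+ d) :* (y :+ d) :+ y :* y) :+ ((y :+ d) :* (y :+ d) :+ y :* y)) refl y d)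
        (+-cong (+-congʳ (*-cong e e)) (+-congʳ (*-cong e e)))))

  -- √ x is the supremum of { y : y² ≤ x } ∪ {0}; the added 0 makes √ total.
  BelowRoot : ℝ → Pred ℝ 0ℓ
  BelowRoot x y = (y ≈ 0#) ⊎ (y * y ≤ x)

  belowRoot-bounded : ∀ x → ∃ (UpperBound (BelowRoot x))
  belowRoot-bounded x = 1# + m , bound
    where
    m = x ⊔ 0#
    m≥0 : 0# ≤ m
    m≥0 = x≤y⊔x x 0#
    1+m≥0 : 0# ≤ 1# + m
    1+m≥0 = +-nonNeg 0≤1 m≥0
    bound : UpperBound (BelowRoot x) (1# + m)
    bound y (inj₁ y≈0)  = ≤-respˡ (sym y≈0) 1+m≥0
    bound y (inj₂ y²≤x) = square-cancel-≤ 1+m≥0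
      (≤-trans (≤-trans y²≤x (x≤x⊔y x 0#))
        (≤-trans (x≤d+x 0≤1)
          (≤-respˡ (*-identityʳ _) (*-monoʳ-≤ 1+m≥0 (x≤x+d m≥0)))))

  √-sup : ∀ x → ∃ (IsSupremum (BelowRoot x))
  √-sup x = complete (BelowRoot x) (0# , inj₁ refl) (belowRoot-bounded x)

  √ : ℝ → ℝ
  √ x = proj₁ (√-sup x)

  √-nonNeg : ∀ x → 0# ≤ √ x
  √-nonNeg x = proj₁ (proj₂ (√-sup x)) 0# (inj₁ refl)

  √²≤ : ∀ {x} → 0# ≤ x → √ x * √ x ≤ x
  √²≤ {x} x≥0 with (√ x * √ x) ≤? x
  ... | yes p = p
  ... | no ¬p = contradiction (proj₂ (proj₂ (√-sup x)) r r-ub) s≰r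
    where
    s = √ x
    s≥0 = √-nonNeg x
    x<s² : x < s * s
    x<s² = ≰⇒> ¬p
    δ = diff (proj₁ x<s²)
    d = proj₁ δ
    d≥0 = proj₁ (proj₂ δ)
    x+d≈s² : x + d ≈ s * s
    x+d≈s² = proj₂ (proj₂ δ)
    s≉0 : ¬ (s ≈ 0#)
    s≉0 e = ¬p (≤-respˡ (sym (trans (*-congʳ e) (zeroˡ s))) x≥0)
    s>0 : 0# < s
    s>0 = s≥0 , s≉0 ∘ sym
    2s>0 : 0# < s + s
    2s>0 = +-nonNeg s≥0 s≥0 , λ e → s≉0 (≤-antisym (≤-respʳ (sym e) (x≤x+d s≥0)) s≥0)
    d>0 : 0# < d
    d>0 = d≥0 , λ e → proj₂ x<s² (trans (sym (+-identityʳ x)) (trans (+-congˡ e) x+d≈s²))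
    2s≉0 = proj₂ 2s>0 ∘ sym
    e = d / (s + s) [ 2s≉0 ]
    e>0 : 0# < e
    e>0 = *-pos d>0 (inverse-pos (proj₁ 2s>0) 2s≉0)
    e*2s≈d : e * (s + s) ≈ d
    e*2s≈d = /-cancel d 2s≉0
    e≤s : e ≤ s
    e≤s = *-cancelʳ-≤ 2s>0 (≤-respˡ (sym e*2s≈d) (≤-trans (x≤d+x x≥0)
            (≤-respˡ (sym x+d≈s²) (*-monoʳ-≤ s≥0 (x≤x+d s≥0)))))
    ρ = diff e≤s
    r = proj₁ ρ
    r≥0 = proj₁ (proj₂ ρ)
    e+r≈s : e + r ≈ s
    e+r≈s = proj₂ (proj₂ ρ)
    r²≈x+e² : x + e * e ≈ r * r
    r²≈x+e² = +-cancelˡ (e * e + (e * r + e * r)) _ _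
      (trans (solve 3 (λ x e r → (e :* e :+ (e :* r :+ e :* r)) :+ (x :+ e :* e)
                       := x :+ e :* ((e :+ r) :+ (e :+ r))) refl x e r)
      (trans (+-congˡ (*-congˡ (+-cong e+r≈s e+r≈s)))
      (trans (+-congˡ e*2s≈d)
      (trans x+d≈s²
      (trans (*-cong (sym e+r≈s) (sym e+r≈s))
        (solve 2 (λ e r → (e :+ r) :* (e :+ r) := (e :* e :+ (e :* r :+ e :* r)) :+ r :* r) refl e r))))))
    r-ub : UpperBound (BelowRoot x) r
    r-ub y (inj₁ y≈0)  = ≤-respˡ (sym y≈0) r≥0
    r-ub y (inj₂ y²≤x) = square-cancel-≤ r≥0 (≤-trans y²≤x (≤-by (square≥0 e) r²≈x+e²))
    s≰r : ¬ (s ≤ r)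
    s≰r q = <⇒≱ e>0 (+-cancelˡ-≤ {r} (≤-respˡ (trans (sym e+r≈s) (+-comm e r)) (≤-respʳ (sym (+-identityʳ r)) q)))

  ≤√² : ∀ x → x ≤ √ x * √ x
  ≤√² x with x ≤? (√ x * √ x)
  ... | yes p = p
  ... | no ¬p = contradiction (proj₁ (proj₂ (√-sup x)) (s + e) (inj₂ s+e-below)) s+e≰s
    where
    s = √ x
    s≥0 = √-nonNeg x
    s²<x : s * s < x
    s²<x = ≰⇒> ¬p
    δ = diff (proj₁ s²<x)
    d = proj₁ δ
    d≥0 = proj₁ (proj₂ δ)
    s²+d≈x : s * s + d ≈ x
    s²+d≈x = proj₂ (proj₂ δ)
    d>0 : 0# < d
    d>0 = d≥0 , λ e → proj₂ s²<x (trans (sym (+-identityʳ _)) (trans (+-congˡ e) s²+d≈x))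
    2s = s + s
    2s≥0 : 0# ≤ 2s
    2s≥0 = +-nonNeg s≥0 s≥0
    q = 2s + (1# + d)
    d≤q : d ≤ q
    d≤q = ≤-trans (x≤d+x 0≤1) (x≤d+x 2s≥0)
    q>0 : 0# < q
    q>0 = ≤-trans d≥0 d≤q , λ e → proj₂ d>0 (≤-antisym d≥0 (≤-respʳ (sym e) d≤q))
    q≉0 = proj₂ q>0 ∘ sym
    e = d / q [ q≉0 ]
    e>0 : 0# < e
    e>0 = *-pos d>0 (inverse-pos (proj₁ q>0) q≉0)
    e*q≈d : e * q ≈ d
    e*q≈d = /-cancel d q≉0
    e≤1 : e ≤ 1#
    e≤1 = *-cancelʳ-≤ q>0 (≤-respˡ (sym e*q≈d) (≤-respʳ (sym (*-identityˡ q)) d≤q))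
    s+e-below : (s + e) * (s + e) ≤ x
    s+e-below = ≤-respˡ (solve 2 (λ s e → s :* s :+ e :* ((s :+ s) :+ e) := (s :+ e) :* (s :+ e)) refl s e)
      (≤-respʳ (trans (+-congˡ e*q≈d) s²+d≈x)
        (+-monoʳ-≤ (s * s) (*-monoʳ-≤ (proj₁ e>0) (+-monoʳ-≤ 2s (≤-trans e≤1 (x≤x+d d≥0))))))
    s+e≰s : ¬ (s + e ≤ s)
    s+e≰s p = <⇒≱ e>0 (+-cancelˡ-≤ (≤-respʳ (sym (+-identityʳ s)) p))

  √-square : ∀ {x} → 0# ≤ x → √ x * √ x ≈ x
  √-square x≥0 = ≤-antisym (√²≤ x≥0) (≤√² _)

  sum-mono : ∀ {n} {f g : Fin n → ℝ} → (∀ i → f i ≤ g i) → sum f ≤ sum g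
  sum-mono {ℕ.zero}  p = ≤-refl
  sum-mono {ℕ.suc n} p = +-mono-≤ (p zero) (sum-mono (p ∘ suc))

  sum-nonNeg : ∀ {n} {f : Fin n → ℝ} → (∀ i → 0# ≤ f i) → 0# ≤ sum f
  sum-nonNeg {ℕ.zero}  p = ≤-refl
  sum-nonNeg {ℕ.suc n} p = +-nonNeg (p zero) (sum-nonNeg (p ∘ suc))

  term≤sum : ∀ {n} {f : Fin n → ℝ} → (∀ i → 0# ≤ f i) → ∀ i → f i ≤ sum f
  term≤sum p zero    = x≤x+d (sum-nonNeg (p ∘ suc))
  term≤sum p (suc i) = ≤-trans (term≤sum (p ∘ suc) i) (x≤d+x (p zero))

  sum-pos⇒term-pos : ∀ {n} (f : Fin n → ℝ) → 0# < sum f → ∃ λ i → 0# < f i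
  sum-pos⇒term-pos {ℕ.zero}  f (_ , n) = contradiction refl n
  sum-pos⇒term-pos {ℕ.suc n} f p with f zero ≤? 0#
  ... | no ¬q = zero , ≰⇒> ¬q
  ... | yes q with sum (f ∘ suc) ≤? 0#
  ...   | yes r = contradiction (≤-respʳ (+-identityˡ 0#) (+-mono-≤ q r)) (<⇒≱ p)
  ...   | no ¬r with sum-pos⇒term-pos (f ∘ suc) (≰⇒> ¬r)
  ...     | i , s = suc i , s

  sum-square : ∀ n → ∃ λ c → (0# ≤ c) × (∀ (f : Fin n → ℝ) → sum f * sum f ≤ c * sum (λ i → f i * f i))
  sum-square ℕ.zero    = 0# , ≤-refl , λ f → ≤-reflexive refl
  sum-square (ℕ.suc n) with sum-square n
  ... | c , c≥0 , p = c′ + c′ , +-nonNeg c′≥0 c′≥0 , step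
    where
    c′ = 1# + c
    c′≥0 : 0# ≤ c′
    c′≥0 = +-nonNeg 0≤1 c≥0
    step : ∀ (f : Fin (ℕ.suc n) → ℝ) → sum f * sum f ≤ (c′ + c′) * sum (λ i → f i * f i)
    step f = ≤-trans ([x+y]²≤2[x²+y²] _ _)
        (≤-respʳ (sym (distribʳ _ c′ c′)) (+-mono-≤ half half))
      where
      a = f zero * f zero
      b = sum (λ i → f (suc i) * f (suc i))
      half : a + sum (f ∘ suc) * sum (f ∘ suc) ≤ c′ * (a + b)
      half = ≤-respʳ (sym (distribˡ c′ a b)) (+-mono-≤
        (≤-respˡ (*-identityˡ a) (*-monoˡ-≤ (square≥0 (f zero)) (x≤x+d c≥0)))
        (≤-trans (p (f ∘ suc)) (*-monoˡ-≤ (sum-nonNeg (λ i → square≥0 (f (suc i)))) (x≤d+x 0≤1))))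

  ∑ : (X : FinSet) → (Elem X → ℝ) → ℝ
  ∑ X f = sum (f ∘ at X)

  infixl 6 ∑
  syntax ∑ X (λ x → e) = ∑[ x ∈ X ] e

  -- The maximum of nonnegative values, hence the base value 0.
  maxOver : (X : FinSet) → (Elem X → ℝ) → ℝ
  maxOver X f = foldr _⊔_ 0# (f ∘ at X)

  ∑-mono : ∀ X {f g : Elem X → ℝ} → (∀ x → f x ≤ g x) → ∑ X f ≤ ∑ X g
  ∑-mono X p = sum-mono (p ∘ at X)

  ∑-nonNeg : ∀ X {f : Elem X → ℝ} → (∀ x → 0# ≤ f x) → 0# ≤ ∑ X f
  ∑-nonNeg X p = sum-nonNeg (p ∘ at X)

  term≤∑ : ∀ X {f : Elem X → ℝ} → (∀ x → 0# ≤ f x) → ∀ x → f x ≤ ∑ X f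
  term≤∑ X {f} p x = ≡.subst (λ y → f y ≤ ∑ X f) (at-index X x) (term≤sum (p ∘ at X) (index X x))

  ∑-pos : ∀ X {f : Elem X → ℝ} → (∀ x → 0# ≤ f x) → ∀ x → 0# < f x → 0# < ∑ X f
  ∑-pos X {f} p x (q , n) = ∑-nonNeg X p , λ e → n (≤-antisym q (≤-respʳ (sym e) (term≤∑ X p x)))

  ∑-pos⇒term-pos : ∀ X {f : Elem X → ℝ} → 0# < ∑ X f → ∃ λ x → 0# < f x
  ∑-pos⇒term-pos X {f} p with sum-pos⇒term-pos (f ∘ at X) p
  ... | i , q = at X i , q

  maxOver-nonNeg : ∀ X f → 0# ≤ maxOver X f
  maxOver-nonNeg X f = go (f ∘ at X)
    where
    go : ∀ {n} (g : Fin n → ℝ) → 0# ≤ foldr _⊔_ 0# g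
    go {ℕ.zero}  g = ≤-refl
    go {ℕ.suc n} g = ≤-trans (go (g ∘ suc)) (x≤y⊔x (g zero) _)

  ≤maxOver : ∀ X f x → f x ≤ maxOver X f
  ≤maxOver X f x = ≡.subst (λ y → f y ≤ maxOver X f) (at-index X x) (go (f ∘ at X) (index X x))
    where
    go : ∀ {n} (g : Fin n → ℝ) i → g i ≤ foldr _⊔_ 0# g
    go g zero    = x≤x⊔y _ _
    go g (suc i) = ≤-trans (go (g ∘ suc) i) (x≤y⊔x (g zero) _)

  if-nonNeg : ∀ b {x} → 0# ≤ x → 0# ≤ (if b then x else 0#)
  if-nonNeg true  p = p
  if-nonNeg false p = ≤-refl

  if-pos : ∀ {A : Set} (_≟_ : DecidableEquality A) {x y a} → 0# < (if ⌊ x ≟ y ⌋ then a else 0#) → x ≡ y × 0# < a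
  if-pos _≟_ {x} {y} p with x ≟ y
  ... | yes e = e , p
  ... | no  _ = contradiction refl (proj₂ p)

  pos-if : ∀ {A : Set} (_≟_ : DecidableEquality A) {x y a} → x ≡ y → 0# < a → 0# < (if ⌊ x ≟ y ⌋ then a else 0#)
  pos-if _≟_ {x} {y} e p with x ≟ y
  ... | yes _ = p
  ... | no ¬e = contradiction e ¬e

  record ProjectionGame : Set₁ where
    field
      U V Alphabet Edge : FinSet
      left       : Elem Edge → Elem U
      right      : Elem Edge → Elem V
      weight     : Elem Edge → ℝ
      -- constraint e α β ≡ true means (α , β) ∈ π for the constraint π of the
      -- edge e; α answers the U-endpoint and β the V-endpoint.
      constraint : Elem Edge → Elem Alphabet → Elem Alphabet → Bool

      weight-nonNeg : ∀ e → 0# ≤ weight e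
      projection    : ∀ e {α α′ β} → constraint e α β ≡ true → constraint e α′ β ≡ true → α ≡ α′
      total-pos     : 0# < ∑ Edge weight

    prob : Elem Edge → ℝ
    prob e = weight e / ∑ Edge weight [ proj₂ total-pos ∘ sym ]

    μU : Elem U → ℝ
    μU u = ∑[ e ∈ Edge ] (if eqᵇ U (left e) u then prob e else 0#)

    μV : Elem V → ℝ
    μV v = ∑[ e ∈ Edge ] (if eqᵇ V (right e) v then prob e else 0#)

    field
      μU-pos : ∀ u → 0# < μU u
      μV-pos : ∀ v → 0# < μV v

    -- The expectation of g over the edge distribution conditioned on u.
    𝔼∣ : Elem U → (Elem Edge → ℝ) → ℝ
    𝔼∣ u g = (∑[ e ∈ Edge ] (if eqᵇ U (left e) u then prob e * g e else 0#)) / μU u [ proj₂ (μU-pos u) ∘ sym ]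

    operator : (Elem V → Elem Alphabet → ℝ) → (Elem U → Elem Alphabet → ℝ)
    operator f u α = 𝔼∣ u (λ e → ∑[ β ∈ Alphabet ] (if constraint e α β then f (right e) β else 0#))

    normSq : (Elem U → Elem Alphabet → ℝ) → ℝ
    normSq g = ∑[ u ∈ U ] (μU u * (∑[ α ∈ Alphabet ] (g u α * g u α)))

    prob-nonNeg : ∀ e → 0# ≤ prob e
    prob-nonNeg e = *-nonNeg (weight-nonNeg e) (proj₁ (inverse-pos (proj₁ total-pos) (proj₂ total-pos ∘ sym)))

  open ProjectionGame

  module _ (G H : ProjectionGame) where

    private
      total⁻¹ : ProjectionGame → ℝ
      total⁻¹ K = proj₁ (inverse (∑ (Edge K) (weight K)) (proj₂ (total-pos K) ∘ sym))

      weight⊗ : Elem (Edge G ×ᶠ Edge H) → ℝ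
      weight⊗ (e , e′) = weight G e * weight H e′

      weight⊗-nonNeg : ∀ e → 0# ≤ weight⊗ e
      weight⊗-nonNeg (e , e′) = *-nonNeg (weight-nonNeg G e) (weight-nonNeg H e′)

      total⊗-pos : 0# < ∑ (Edge G ×ᶠ Edge H) weight⊗
      total⊗-pos with ∑-pos⇒term-pos (Edge G) (total-pos G) | ∑-pos⇒term-pos (Edge H) (total-pos H)
      ... | e , p | e′ , q = ∑-pos (Edge G ×ᶠ Edge H) weight⊗-nonNeg (e , e′) (*-pos p q)

      prob⊗ : Elem (Edge G ×ᶠ Edge H) → ℝ
      prob⊗ e = weight⊗ e / ∑ (Edge G ×ᶠ Edge H) weight⊗ [ proj₂ total⊗-pos ∘ sym ]

      total⊗⁻¹-pos = inverse-pos (proj₁ total⊗-pos) (proj₂ total⊗-pos ∘ sym)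

      measure⊗-pos : ∀ (X Y : FinSet) (l : Elem (Edge G) → Elem X) (l′ : Elem (Edge H) → Elem Y) x y →
        0# < ∑[ e ∈ Edge G ] (if eqᵇ X (l e) x then prob G e else 0#) →
        0# < ∑[ e ∈ Edge H ] (if eqᵇ Y (l′ e) y then prob H e else 0#) →
        0# < ∑[ e ∈ Edge G ×ᶠ Edge H ] (if eqᵇ (X ×ᶠ Y) (l (proj₁ e) , l′ (proj₂ e)) (x , y) then prob⊗ e else 0#)
      measure⊗-pos X Y l l′ x y p q with ∑-pos⇒term-pos (Edge G) p | ∑-pos⇒term-pos (Edge H) q
      ... | e , r | e′ , s with if-pos (FinSet._≟_ X) r | if-pos (FinSet._≟_ Y) s
      ... | eq , r′ | eq′ , s′ = ∑-pos (Edge G ×ᶠ Edge H)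
            (λ e → if-nonNeg (eqᵇ (X ×ᶠ Y) (l (proj₁ e) , l′ (proj₂ e)) (x , y)) (*-nonNeg (weight⊗-nonNeg e) (proj₁ total⊗⁻¹-pos)))
            (e , e′)
            (pos-if (FinSet._≟_ (X ×ᶠ Y)) (≡.cong₂ _,_ eq eq′)
              (*-pos (*-pos (pos-factorˡ (total⁻¹ G) (weight-nonNeg G e) r′) (pos-factorˡ (total⁻¹ H) (weight-nonNeg H e′) s′)) total⊗⁻¹-pos))

      ∧-true : ∀ {b c} → b ∧ c ≡ true → b ≡ true × c ≡ true
      ∧-true {true} p = ≡.refl , p

    infixr 7 _⊗_

    _⊗_ : ProjectionGame
    _⊗_ = record
      { U             = U G ×ᶠ U H
      ; V             = V G ×ᶠ V H
      ; Alphabet      = Alphabet G ×ᶠ Alphabet H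
      ; Edge          = Edge G ×ᶠ Edge H
      ; left          = λ (e , e′) → left G e , left H e′
      ; right         = λ (e , e′) → right G e , right H e′
      ; weight        = weight⊗
      ; constraint    = λ (e , e′) (α , α′) (β , β′) → constraint G e α β ∧ constraint H e′ α′ β′
      ; weight-nonNeg = weight⊗-nonNeg
      ; projection    = λ (e , e′) p q →
          let p₁ , p₂ = ∧-true p
              q₁ , q₂ = ∧-true q
          in ≡.cong₂ _,_ (projection G e p₁ q₁) (projection H e′ p₂ q₂)
      ; total-pos     = total⊗-pos
      ; μU-pos        = λ (u , u′) → measure⊗-pos (U G) (U H) (left G) (left H) u u′ (μU-pos G u) (μU-pos H u′)
      ; μV-pos        = λ (v , v′) → measure⊗-pos (V G) (V H) (right G) (right H) v v′ (μV-pos G v) (μV-pos H v′)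
      }

  -- A finite measure space, its points numbered so that all such spaces form
  -- a small type.
  record MeasureSpace : Set where
    field
      points   : ℕ
      μ        : Fin points → ℝ
      μ-nonNeg : ∀ ω → 0# ≤ μ ω

    Point : Set
    Point = Fin points

    ∫ : (Point → ℝ) → ℝ
    ∫ g = sum (λ ω → μ ω * g ω)

    ∫-mono : ∀ {g h} → (∀ ω → g ω ≤ h ω) → ∫ g ≤ ∫ h
    ∫-mono p = sum-mono (λ ω → *-monoʳ-≤ (μ-nonNeg ω) (p ω))

    ∫-nonNeg : ∀ {g} → (∀ ω → 0# ≤ g ω) → 0# ≤ ∫ g
    ∫-nonNeg p = sum-nonNeg (λ ω → *-nonNeg (μ-nonNeg ω) (p ω))

  open MeasureSpace using (Point; ∫; ∫-mono; ∫-nonNeg)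

  module _ (G : ProjectionGame) (Ω : MeasureSpace) (f : Elem (V G) → Elem (Alphabet G) → Point Ω → ℝ) where

    -- ‖(G ⊗ Id) f‖
    ‖⊗Id‖ : ℝ
    ‖⊗Id‖ = √ (∫ Ω (λ ω → normSq G (operator G (λ v β → f v β ω))))

    -- ‖(T_v ⊗ Id) f‖
    ‖T⊗Id‖ : Elem (V G) → ℝ
    ‖T⊗Id‖ v = √ (∫ Ω (λ ω → (∑[ β ∈ Alphabet G ] f v β ω) * (∑[ β ∈ Alphabet G ] f v β ω)))

    max‖T⊗Id‖ : ℝ
    max‖T⊗Id‖ = maxOver (V G) ‖T⊗Id‖

  record Ratio (G : ProjectionGame) (t : ℝ) : Set where
    field
      Ω         : MeasureSpace
      f         : Elem (V G) → Elem (Alphabet G) → Point Ω → ℝ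
      f-nonNeg  : ∀ v β ω → 0# ≤ f v β ω
      nonzero   : ¬ (max‖T⊗Id‖ G Ω f ≈ 0#)
      value     : t ≈ ‖⊗Id‖ G Ω f / max‖T⊗Id‖ G Ω f [ nonzero ]

  -- The ratios are nonnegative and their supremum is taken in [0,∞); adjoining
  -- 0 matters only for an empty alphabet, where there are no ratios at all.
  Ratio₀ : ProjectionGame → Pred ℝ 0ℓ
  Ratio₀ G t = (t ≈ 0#) ⊎ Ratio G t

  -- A crude bound; its only use is that the supremum below exists.
  module Bound (G : ProjectionGame) where

    A = Alphabet G

    sq = sum-square (size (V G))
    c = proj₁ sq
    c≥0 = proj₁ (proj₂ sq)

    Q N C : ℝ
    Q = ∑[ u ∈ U G ] (μU G u * (∑[ α ∈ A ] 1#))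
    N = ∑[ v ∈ V G ] 1#
    C = Q * (c * N)

    μU≥0 : ∀ u → 0# ≤ μU G u
    μU≥0 u = proj₁ (μU-pos G u)

    Q≥0 : 0# ≤ Q
    Q≥0 = ∑-nonNeg (U G) (λ u → *-nonNeg (μU≥0 u) (∑-nonNeg A (λ _ → 0≤1)))

    if-≤ : ∀ b {x} → 0# ≤ x → (if b then x else 0#) ≤ x
    if-≤ true  p = ≤-refl
    if-≤ false p = p

    if-* : ∀ b {x y z} → 0# ≤ x → y ≤ z → (if b then x * y else 0#) ≤ (if b then x else 0#) * z
    if-* true  p q = *-monoʳ-≤ p q
    if-* false {z = z} p q = ≤-reflexive (sym (zeroˡ z))

    module _ (f : Elem (V G) → Elem A → ℝ) (f≥0 : ∀ v β → 0# ≤ f v β) where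

      S : ℝ
      S = ∑[ v ∈ V G ] ∑ A (f v)

      operator≤ : ∀ u α → operator G f u α ≤ S
      operator≤ u α = ≤-trans
        (*-monoˡ-≤ (proj₁ (inverse-pos (μU≥0 u) n))
          (≤-respʳ (sym (*-distribʳ-sum S (λ i → if eqᵇ (U G) (left G (at (Edge G) i)) u then prob G (at (Edge G) i) else 0#)))
            (∑-mono (Edge G) (λ e →
              if-* (eqᵇ (U G) (left G e) u) (prob-nonNeg G e)
                (≤-trans (∑-mono A (λ j → if-≤ (constraint G e α j) (f≥0 (right G e) j)))
                  (term≤∑ (V G) {λ v → ∑ A (f v)} (λ v → ∑-nonNeg A (f≥0 v)) (right G e)))))))
        (≤-reflexive (trans (*-congʳ (*-comm _ S)) (trans (*-assoc S _ _)
          (trans (*-congˡ (proj₂ (inverse (μU G u) n))) (*-identityʳ S)))))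
        where n = proj₂ (μU-pos G u) ∘ sym

      operator≥0 : ∀ u α → 0# ≤ operator G f u α
      operator≥0 u α = *-nonNeg
        (∑-nonNeg (Edge G) (λ e →
          if-nonNeg (eqᵇ (U G) (left G e) u) (*-nonNeg (prob-nonNeg G e)
            (∑-nonNeg A (λ j → if-nonNeg (constraint G e α j) (f≥0 (right G e) j))))))
        (proj₁ (inverse-pos (μU≥0 u) (proj₂ (μU-pos G u) ∘ sym)))

      normSq≤ : normSq G (operator G f) ≤ Q * (c * (∑[ v ∈ V G ] (∑ A (f v) * ∑ A (f v))))
      normSq≤ = ≤-trans
        (∑-mono (U G) (λ u → ≤-respʳ (trans (*-congˡ ones) (sym (*-assoc _ _ _)))
          (*-monoʳ-≤ (μU≥0 u) (∑-mono A (λ α → square-mono-≤ (operator≥0 u α) (operator≤ u α))))))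
        (≤-respˡ (*-distribʳ-sum {size (U G)} (S * S) _) (*-monoʳ-≤ Q≥0 (proj₂ (proj₂ sq) (λ i → ∑ A (f (at (V G) i))))))
        where
        ones : sum {size A} (λ j → S * S) ≈ sum {size A} (λ j → 1#) * (S * S)
        ones = trans (sum-cong-≋ {size A} (λ j → sym (*-identityˡ _))) (sym (*-distribʳ-sum {size A} (S * S) (λ _ → 1#)))

    module _ (Ω : MeasureSpace) (f : Elem (V G) → Elem A → Point Ω → ℝ) (f≥0 : ∀ v β ω → 0# ≤ f v β ω) where

      open MeasureSpace Ω using (μ; points)

      D = max‖T⊗Id‖ G Ω f

      D≥0 : 0# ≤ D
      D≥0 = maxOver-nonNeg (V G) (‖T⊗Id‖ G Ω f)

      h : Elem (V G) → Point Ω → ℝ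
      h v ω = (∑[ β ∈ A ] f v β ω) * (∑[ β ∈ A ] f v β ω)

      T≤ : ∀ v → ∫ Ω (h v) ≤ D * D
      T≤ v = ≤-trans (≤√² _) (square-mono-≤ (√-nonNeg _) (≤maxOver (V G) (‖T⊗Id‖ G Ω f) v))

      ∫-∑ : ∫ Ω (λ ω → ∑[ v ∈ V G ] h v ω) ≈ ∑[ v ∈ V G ] ∫ Ω (h v)
      ∫-∑ = trans (sum-cong-≋ {points} (λ ω → *-distribˡ-sum {size (V G)} (μ ω) _))
              (∑-comm {points} {size (V G)} (λ ω i → μ ω * h (at (V G) i) ω))

      ∫-scale : ∀ k g → ∫ Ω (λ ω → k * g ω) ≈ k * ∫ Ω g
      ∫-scale k g = trans (sum-cong-≋ {points} (λ ω → trans (sym (*-assoc _ _ _)) (trans (*-congʳ (*-comm _ k)) (*-assoc _ _ _))))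
                      (sym (*-distribˡ-sum {points} k (λ ω → μ ω * g ω)))

      norm²≤ : ∫ Ω (λ ω → normSq G (operator G (λ v β → f v β ω))) ≤ C * (D * D)
      norm²≤ = ≤-trans (∫-mono Ω (λ ω → normSq≤ (λ v β → f v β ω) (λ v β → f≥0 v β ω)))
        (≤-respˡ (sym (trans (∫-scale Q _) (*-congˡ (trans (∫-scale c _) (*-congˡ ∫-∑)))))
        (≤-respʳ (sym (trans (*-assoc Q _ _) (*-congˡ (*-assoc c N _))))
          (*-monoʳ-≤ Q≥0 (*-monoʳ-≤ c≥0
            (≤-respʳ (trans (sum-cong-≋ {size (V G)} (λ i → sym (*-identityˡ _))) (sym (*-distribʳ-sum {size (V G)} (D * D) (λ _ → 1#))))
              (∑-mono (V G) T≤))))))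

      normSq≥0 : ∀ ω → 0# ≤ normSq G (operator G (λ v β → f v β ω))
      normSq≥0 ω = ∑-nonNeg (U G) (λ u → *-nonNeg (μU≥0 u) (∑-nonNeg A (λ α → square≥0 (operator G (λ v β → f v β ω) u α))))

      norm≤ : ‖⊗Id‖ G Ω f ≤ √ C * D
      norm≤ = square-cancel-≤ (*-nonNeg (√-nonNeg C) D≥0)
        (≤-trans (√²≤ (∫-nonNeg Ω normSq≥0))
          (≤-trans norm²≤
            (≤-trans (*-monoˡ-≤ (square≥0 D) (≤√² C))
              (≤-reflexive (solve 2 (λ a b → (a :* a) :* (b :* b) := (a :* b) :* (a :* b)) refl (√ C) D)))))

    ratios-bounded : ∃ (UpperBound (Ratio₀ G))
    ratios-bounded = √ C , bound
      where
      bound : UpperBound (Ratio₀ G) (√ C)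
      bound t (inj₁ t≈0) = ≤-respˡ (sym t≈0) (√-nonNeg C)
      bound t (inj₂ r) = ≤-respˡ (sym value) (*-cancelʳ-≤ (D≥0 Ω f f-nonNeg , nonzero ∘ sym)
        (≤-respˡ (sym (/-cancel _ nonzero)) (norm≤ Ω f f-nonNeg)))
        where open Ratio r

  val₊-sup : ∀ G → ∃ (IsSupremum (Ratio₀ G))
  val₊-sup G = complete (Ratio₀ G) (0# , inj₁ refl) (Bound.ratios-bounded G)

  val₊ : ProjectionGame → ℝ
  val₊ G = proj₁ (val₊-sup G)

{-# OPTIONS --safe #-}

-- The operator of G ⊗ H is the composite of G acting on the first coordinates
-- and H acting on the second ones. For the upper bound, apply H first: for
-- fixed (u′, α′, ω) the result is a test function for G, so U′ × Σ′ × Ω is a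
-- measure space to which val₊ G applies; summing out β turns the bound that is
-- left over, for each v, into an instance of val₊ H. For the lower bound, the
-- tensor product of two test functions multiplies all the norms.

module Submission where

open import Defs
open import Data.Bool.Base using (Bool; true; false; _∧_; if_then_else_)
open import Data.Fin.Base using (Fin; zero; suc; _↑ˡ_; _↑ʳ_; combine)
import Data.Fin.Properties as Fin
open import Data.Nat.Base as ℕ using (ℕ)
open import Data.Product.Base using (_×_; _,_; proj₁; proj₂)
open import Data.Sum.Base using (inj₁; inj₂)
open import Data.Vec.Functional using (foldr)
open import Function.Base using (_∘_)
open import Function.Construct.Identity using (↔-id)
open import Relation.Binary.PropositionalEquality.Core as ≡ using (_≡_)
open import Relation.Nullary using (¬_; yes; no; contradiction)

open FinSet using (Elem; size; at; eqᵇ)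

module _ (R : CompleteOrderedField) where

  open CompleteOrderedField R hiding (zero) renaming (Carrier to ℝ)
  open Games R
  open ProjectionGame
  open MeasureSpace using (Point; points; μ; μ-nonNeg; ∫-nonNeg)
  open import Algebra.Construct.NaturalChoice.Max ≤-totalOrder using (⊔-lub)
  open import Algebra.Solver.Ring.NaturalCoefficients.Default commutativeSemiring
    using (solve; _:=_; _:*_)
  open import Relation.Binary.Reasoning.Setoid setoid

  -- Products, inverses and finite double sums.

  *-swap-middle : ∀ a b c d → (a * b) * (c * d) ≈ (a * c) * (b * d)
  *-swap-middle = solve 4 (λ a b c d → (a :* b) :* (c :* d) := (a :* c) :* (b :* d)) refl

  x*yz≈y*xz : ∀ x y z → x * (y * z) ≈ y * (x * z)
  x*yz≈y*xz = solve 3 (λ x y z → x :* (y :* z) := y :* (x :* z)) refl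

  -- Inverses are unique: expanding `z` against `(a * x) * (b * y)`, which is 1, leaves `z * c`,
  -- which is also 1, times `x * y`. This carries multiplicativity of total weights and vertex
  -- measures over to their normalising factors.
  inverse-* : ∀ {a b c} (a≉0 : ¬ (a ≈ 0#)) (b≉0 : ¬ (b ≈ 0#)) (c≉0 : ¬ (c ≈ 0#)) → c ≈ a * b →
    proj₁ (inverse c c≉0) ≈ proj₁ (inverse a a≉0) * proj₁ (inverse b b≉0)
  inverse-* {a} {b} {c} a≉0 b≉0 c≉0 c≈ab with inverse a a≉0 | inverse b b≉0 | inverse c c≉0
  ... | x , ax≈1 | y , by≈1 | z , cz≈1 = begin
    z                          ≈⟨ *-identityʳ z ⟨
    z * 1#                     ≈⟨ *-congˡ (*-identityʳ 1#) ⟨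
    z * (1# * 1#)              ≈⟨ *-congˡ (*-cong ax≈1 by≈1) ⟨
    z * ((a * x) * (b * y))    ≈⟨ *-congˡ (*-swap-middle a x b y) ⟩
    z * ((a * b) * (x * y))    ≈⟨ *-congˡ (*-congʳ c≈ab) ⟨
    z * (c * (x * y))          ≈⟨ *-assoc z c _ ⟨
    (z * c) * (x * y)          ≈⟨ *-congʳ (trans (*-comm z c) cz≈1) ⟩
    1# * (x * y)               ≈⟨ *-identityˡ _ ⟩
    x * y                      ∎

  sum-↑ : ∀ m {n} (f : Fin (m ℕ.+ n) → ℝ) → sum f ≈ sum (λ i → f (i ↑ˡ n)) + sum (λ j → f (m ↑ʳ j))
  sum-↑ ℕ.zero    f = sym (+-identityˡ _)
  sum-↑ (ℕ.suc m) f = trans (+-congˡ (sum-↑ m (f ∘ suc))) (sym (+-assoc _ _ _))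

  sum-combine : ∀ m n (f : Fin (m ℕ.* n) → ℝ) → sum f ≈ sum {m} (λ i → sum {n} (λ j → f (combine i j)))
  sum-combine ℕ.zero    n f = refl
  sum-combine (ℕ.suc m) n f = trans (sum-↑ n f) (+-congˡ (sum-combine m n (f ∘ (n ↑ʳ_))))

  opaque

    -- ∑ unfolds to a sum over Fin n, which hides its summand from unification;
    -- this copy does not unfold.
    ∑ᵒ : (X : FinSet) → (Elem X → ℝ) → ℝ
    ∑ᵒ = ∑

    ∑≈∑ᵒ : ∀ X f → ∑ X f ≈ ∑ᵒ X f
    ∑≈∑ᵒ X f = refl

    ∑ᵒ-nonNeg : ∀ X {f : Elem X → ℝ} → (∀ x → 0# ≤ f x) → 0# ≤ ∑ᵒ X f
    ∑ᵒ-nonNeg = ∑-nonNeg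

    ∑-cong : ∀ X {f g : Elem X → ℝ} → (∀ x → f x ≈ g x) → ∑ᵒ X f ≈ ∑ᵒ X g
    ∑-cong X p = sum-cong-≋ {size X} (λ i → p (at X i))

    *-distribˡ-∑ : ∀ X c (f : Elem X → ℝ) → c * ∑ᵒ X f ≈ ∑ᵒ X (λ x → c * f x)
    *-distribˡ-∑ X c f = *-distribˡ-sum c (f ∘ at X)

    *-distribʳ-∑ : ∀ X c (f : Elem X → ℝ) → ∑ᵒ X f * c ≈ ∑ᵒ X (λ x → f x * c)
    *-distribʳ-∑ X c f = *-distribʳ-sum c (f ∘ at X)

    ∑-swap : ∀ X Y (f : Elem X → Elem Y → ℝ) → ∑ᵒ X (λ x → ∑ᵒ Y (f x)) ≈ ∑ᵒ Y (λ y → ∑ᵒ X (λ x → f x y))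
    ∑-swap X Y f = ∑-comm {size X} {size Y} (λ i j → f (at X i) (at Y j))

    ∑-× : ∀ X Y (f : Elem (X ×ᶠ Y) → ℝ) → ∑ᵒ (X ×ᶠ Y) f ≈ ∑ᵒ X (λ x → ∑ᵒ Y (λ y → f (x , y)))
    ∑-× X Y f = trans (sum-combine (size X) (size Y) (f ∘ at (X ×ᶠ Y)))
      (sum-cong-≋ {size X} (λ i → sum-cong-≋ {size Y} (λ j →
        -- An index of `X ×ᶠ Y` is decoded by `remQuot`, which inverts `combine`.
        reflexive (≡.cong (λ (k , l) → f (at X k , at Y l)) (Fin.remQuot-combine i j)))))

    -- Definitional here, where `∑ᵒ` unfolds. In proofs where it does not, this equation is the
    -- passage from `operator` to sums that the lemmas on `∑ᵒ` can rewrite.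
    operator-def : ∀ G f u α → operator G f u α ≈
      ∑ᵒ (Edge G) (λ e → if eqᵇ (U G) (left G e) u
        then prob G e * ∑ᵒ (Alphabet G) (λ β → if constraint G e α β then f (right G e) β else 0#) else 0#)
      * proj₁ (inverse (μU G u) (proj₂ (μU-pos G u) ∘ sym))
    operator-def G f u α = refl

    normSq-def : ∀ G g → normSq G g ≈ ∑ᵒ (U G) (λ u → μU G u * ∑ᵒ (Alphabet G) (λ α → g u α * g u α))
    normSq-def G g = refl

  infixl 6 ∑ᵒ
  syntax ∑ᵒ X (λ x → e) = ∑ᵒ[ x ∈ X ] e

  ∑-*-∑ : ∀ X Y (f : Elem X → ℝ) (g : Elem Y → ℝ) → ∑ᵒ[ x ∈ X ×ᶠ Y ] (f (proj₁ x) * g (proj₂ x)) ≈ ∑ᵒ X f * ∑ᵒ Y g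
  ∑-*-∑ X Y f g = begin
    ∑ᵒ[ x ∈ X ×ᶠ Y ] (f (proj₁ x) * g (proj₂ x))  ≈⟨ ∑-× X Y _ ⟩
    ∑ᵒ[ x ∈ X ] (∑ᵒ[ y ∈ Y ] (f x * g y))          ≈⟨ ∑-cong X (λ x → *-distribˡ-∑ Y (f x) g) ⟨
    ∑ᵒ[ x ∈ X ] (f x * ∑ᵒ Y g)                     ≈⟨ *-distribʳ-∑ X (∑ᵒ Y g) f ⟨
    ∑ᵒ X f * ∑ᵒ Y g                                ∎

  square-* : ∀ a b → (a * b) * (a * b) ≈ (a * a) * (b * b)
  square-* a b = *-swap-middle a b a b

  maxOver-lub : ∀ X {f b} → 0# ≤ b → (∀ x → f x ≤ b) → maxOver X f ≤ b
  maxOver-lub X {f} {b} b≥0 p = go (p ∘ at X)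
    where
    go : ∀ {n} {g : Fin n → ℝ} → (∀ i → g i ≤ b) → foldr _⊔_ 0# g ≤ b
    go {ℕ.zero}  q = b≥0
    go {ℕ.suc n} q = ⊔-lub (q zero) (go (q ∘ suc))

  √-mono : ∀ {x y} → 0# ≤ x → x ≤ y → √ x ≤ √ y
  √-mono x≥0 x≤y = square-cancel-≤ (√-nonNeg _) (≤-trans (√²≤ x≥0) (≤-trans x≤y (≤√² _)))

  -- The operator of a game as a kernel over edges and answers.

  indicator : Bool → ℝ
  indicator b = if b then 1# else 0#

  if≈indicator : ∀ b x → (if b then x else 0#) ≈ indicator b * x
  if≈indicator true  x = sym (*-identityˡ x)
  if≈indicator false x = sym (zeroˡ x)

  indicator-∧ : ∀ b c → indicator (b ∧ c) ≈ indicator b * indicator c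
  indicator-∧ true  c = sym (*-identityˡ _)
  indicator-∧ false c = sym (zeroˡ _)

  if-∧ : ∀ b c x y → (if b ∧ c then x * y else 0#) ≈ (if b then x else 0#) * (if c then y else 0#)
  if-∧ true  true  x y = refl
  if-∧ true  false x y = sym (zeroʳ x)
  if-∧ false c     x y = sym (zeroˡ _)

  if-congʳ : ∀ b {x y} → x ≈ y → (if b then x else 0#) ≈ (if b then y else 0#)
  if-congʳ true  p = p
  if-congʳ false p = refl

  -- Equality on `X ×ᶠ Y` is decided by comparing indices in a single `Fin`, so it does not compute
  -- to a conjunction; the case split checks that both sides decide the same proposition.
  eqᵇ-× : ∀ X Y (x x′ : Elem X) (y y′ : Elem Y) → eqᵇ (X ×ᶠ Y) (x , y) (x′ , y′) ≡ eqᵇ X x x′ ∧ eqᵇ Y y y′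
  eqᵇ-× X Y x x′ y y′ with FinSet._≟_ (X ×ᶠ Y) (x , y) (x′ , y′) | FinSet._≟_ X x x′ | FinSet._≟_ Y y y′
  ... | yes p | yes q | yes r = ≡.refl
  ... | yes p | yes q | no ¬r = contradiction (≡.cong proj₂ p) ¬r
  ... | yes p | no ¬q | _     = contradiction (≡.cong proj₁ p) ¬q
  ... | no ¬p | yes q | yes r = contradiction (≡.cong₂ _,_ q r) ¬p
  ... | no ¬p | yes q | no ¬r = ≡.refl
  ... | no ¬p | no ¬q | _     = ≡.refl

  incidence : (G : ProjectionGame) → Elem (U G) → Elem (Edge G) → ℝ
  incidence G u e = if eqᵇ (U G) (left G e) u then prob G e else 0#

  μU⁻¹ : (G : ProjectionGame) → Elem (U G) → ℝ
  μU⁻¹ G u = proj₁ (inverse (μU G u) (proj₂ (μU-pos G u) ∘ sym))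

  -- The first factor is the probability of the edge `e` conditioned on `u`.
  kernel : (G : ProjectionGame) → Elem (U G) → Elem (Alphabet G) → Elem (Edge G) → Elem (Alphabet G) → ℝ
  kernel G u α e β = (incidence G u e * μU⁻¹ G u) * indicator (constraint G e α β)

  -- Pulling the division by `μU G u` into the sum and turning conditionals into 0-1 factors leaves
  -- coefficients independent of `f`. Linearity of the operator and its behaviour under `⊗` then
  -- reduce to rearranging finite sums.
  operator≈kernel : ∀ G f u α →
    operator G f u α ≈ ∑ᵒ[ e ∈ Edge G ] (∑ᵒ[ β ∈ Alphabet G ] (kernel G u α e β * f (right G e) β))
  operator≈kernel G f u α = begin
    operator G f u α
      ≈⟨ trans (operator-def G f u α) (*-distribʳ-∑ (Edge G) (μU⁻¹ G u) _) ⟩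
    ∑ᵒ[ e ∈ Edge G ] ((if eqᵇ (U G) (left G e) u then prob G e * s e else 0#) * μU⁻¹ G u)
      ≈⟨ ∑-cong (Edge G) (λ e → *-congʳ (if-* (eqᵇ (U G) (left G e) u) _ _)) ⟩
    ∑ᵒ[ e ∈ Edge G ] ((incidence G u e * s e) * μU⁻¹ G u)
      ≈⟨ ∑-cong (Edge G) (λ e → solve 3 (λ a b c → (a :* b) :* c := (a :* c) :* b) refl (incidence G u e) (s e) (μU⁻¹ G u)) ⟩
    ∑ᵒ[ e ∈ Edge G ] ((incidence G u e * μU⁻¹ G u) * s e)
      ≈⟨ ∑-cong (Edge G) (λ e → trans (*-distribˡ-∑ (Alphabet G) (incidence G u e * μU⁻¹ G u) _)
           (∑-cong (Alphabet G) (λ β → trans (*-congˡ (if≈indicator (constraint G e α β) _)) (sym (*-assoc _ _ _))))) ⟩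
    ∑ᵒ[ e ∈ Edge G ] (∑ᵒ[ β ∈ Alphabet G ] (kernel G u α e β * f (right G e) β)) ∎
    where
    s : Elem (Edge G) → ℝ
    s e = ∑ᵒ[ β ∈ Alphabet G ] (if constraint G e α β then f (right G e) β else 0#)
    if-* : ∀ b x y → (if b then x * y else 0#) ≈ (if b then x else 0#) * y
    if-* true  x y = refl
    if-* false x y = sym (zeroˡ y)

  operator-cong : ∀ G {f g} → (∀ v β → f v β ≈ g v β) → ∀ u α → operator G f u α ≈ operator G g u α
  operator-cong G {f} {g} p u α = trans (operator≈kernel G f u α)
    (trans (∑-cong (Edge G) (λ e → ∑-cong (Alphabet G) (λ β → *-congˡ (p (right G e) β)))) (sym (operator≈kernel G g u α)))

  operator-* : ∀ G c f u α → operator G (λ v β → c * f v β) u α ≈ c * operator G f u α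
  operator-* G c f u α = begin
    operator G (λ v β → c * f v β) u α
      ≈⟨ operator≈kernel G (λ v β → c * f v β) u α ⟩
    ∑ᵒ[ e ∈ E ] (∑ᵒ[ β ∈ A ] (k e β * (c * f (r e) β)))
      ≈⟨ ∑-cong E (λ e → ∑-cong A (λ β → x*yz≈y*xz (k e β) c (f (r e) β))) ⟩
    ∑ᵒ[ e ∈ E ] (∑ᵒ[ β ∈ A ] (c * (k e β * f (r e) β)))
      ≈⟨ ∑-cong E (λ e → *-distribˡ-∑ A c _) ⟨
    ∑ᵒ[ e ∈ E ] (c * (∑ᵒ[ β ∈ A ] (k e β * f (r e) β)))
      ≈⟨ *-distribˡ-∑ E c _ ⟨
    c * (∑ᵒ[ e ∈ E ] (∑ᵒ[ β ∈ A ] (k e β * f (r e) β)))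
      ≈⟨ *-congˡ (operator≈kernel G f u α) ⟨
    c * operator G f u α ∎
    where
    E = Edge G
    A = Alphabet G
    r = right G
    k = kernel G u α

  operator-∑ : ∀ G X (f : Elem X → Elem (V G) → Elem (Alphabet G) → ℝ) u α →
    operator G (λ v β → ∑ᵒ[ x ∈ X ] f x v β) u α ≈ ∑ᵒ[ x ∈ X ] operator G (f x) u α
  operator-∑ G X f u α = begin
    operator G (λ v β → ∑ᵒ[ x ∈ X ] f x v β) u α
      ≈⟨ operator≈kernel G (λ v β → ∑ᵒ[ x ∈ X ] f x v β) u α ⟩
    ∑ᵒ[ e ∈ E ] (∑ᵒ[ β ∈ A ] (k e β * (∑ᵒ[ x ∈ X ] f x (r e) β)))
      ≈⟨ ∑-cong E (λ e → ∑-cong A (λ β → *-distribˡ-∑ X (k e β) _)) ⟩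
    ∑ᵒ[ e ∈ E ] (∑ᵒ[ β ∈ A ] (∑ᵒ[ x ∈ X ] (k e β * f x (r e) β)))
      ≈⟨ ∑-cong E (λ e → ∑-swap A X _) ⟩
    ∑ᵒ[ e ∈ E ] (∑ᵒ[ x ∈ X ] (∑ᵒ[ β ∈ A ] (k e β * f x (r e) β)))
      ≈⟨ ∑-swap E X _ ⟩
    ∑ᵒ[ x ∈ X ] (∑ᵒ[ e ∈ E ] (∑ᵒ[ β ∈ A ] (k e β * f x (r e) β)))
      ≈⟨ ∑-cong X (λ x → operator≈kernel G (f x) u α) ⟨
    ∑ᵒ[ x ∈ X ] operator G (f x) u α ∎
    where
    E = Edge G
    A = Alphabet G
    r = right G
    k = kernel G u α

  -- Factorisation of the product game.

  module _ (G H : ProjectionGame) where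

    -- The total weight of the product splits into a product of two sums, hence so does its inverse.
    prob-⊗ : ∀ e e′ → prob (G ⊗ H) (e , e′) ≈ prob G e * prob H e′
    prob-⊗ e e′ = trans
      (*-congˡ (inverse-* (proj₂ (total-pos G) ∘ sym) (proj₂ (total-pos H) ∘ sym) (proj₂ (total-pos (G ⊗ H)) ∘ sym)
        (trans (∑≈∑ᵒ (Edge G ×ᶠ Edge H) _) (trans (∑-*-∑ (Edge G) (Edge H) (weight G) (weight H))
          (sym (*-cong (∑≈∑ᵒ (Edge G) _) (∑≈∑ᵒ (Edge H) _)))))))
      (*-swap-middle _ _ _ _)

    incidence-⊗ : ∀ u u′ e e′ → incidence (G ⊗ H) (u , u′) (e , e′) ≈ incidence G u e * incidence H u′ e′
    incidence-⊗ u u′ e e′ rewrite eqᵇ-× (U G) (U H) (left G e) u (left H e′) u′ =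
      trans (if-congʳ (eqᵇ (U G) (left G e) u ∧ eqᵇ (U H) (left H e′) u′) (prob-⊗ e e′))
        (if-∧ (eqᵇ (U G) (left G e) u) (eqᵇ (U H) (left H e′) u′) (prob G e) (prob H e′))

    μU-⊗ : ∀ u u′ → μU (G ⊗ H) (u , u′) ≈ μU G u * μU H u′
    μU-⊗ u u′ = trans (∑≈∑ᵒ (Edge G ×ᶠ Edge H) (incidence (G ⊗ H) (u , u′)))
      (trans (∑-cong (Edge G ×ᶠ Edge H) (λ (e , e′) → incidence-⊗ u u′ e e′))
      (trans (∑-*-∑ (Edge G) (Edge H) (incidence G u) (incidence H u′))
        (sym (*-cong (∑≈∑ᵒ (Edge G) (incidence G u)) (∑≈∑ᵒ (Edge H) (incidence H u′))))))

    -- Independence of the two edges factors the conditional probability, and the conjunction of the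
    -- constraints factors the indicator.
    kernel-⊗ : ∀ u u′ α α′ e e′ β β′ →
      kernel (G ⊗ H) (u , u′) (α , α′) (e , e′) (β , β′) ≈ kernel G u α e β * kernel H u′ α′ e′ β′
    kernel-⊗ u u′ α α′ e e′ β β′ = trans
      (*-cong
        (trans (*-cong (incidence-⊗ u u′ e e′)
            (inverse-* (proj₂ (μU-pos G u) ∘ sym) (proj₂ (μU-pos H u′) ∘ sym) (proj₂ (μU-pos (G ⊗ H) (u , u′)) ∘ sym) (μU-⊗ u u′)))
          (*-swap-middle _ _ _ _))
        (indicator-∧ (constraint G e α β) (constraint H e′ α′ β′)))
      (*-swap-middle _ _ _ _)

    -- Once the kernel is factored, the sums over `e′` and `β′` close up into the operator of `H`,
    -- with `right G e` and `β` as parameters.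
    operator-⊗ : ∀ f u u′ α α′ →
      operator (G ⊗ H) f (u , u′) (α , α′) ≈
      operator G (λ v β → operator H (λ v′ β′ → f (v , v′) (β , β′)) u′ α′) u α
    operator-⊗ f u u′ α α′ = begin
      operator (G ⊗ H) f (u , u′) (α , α′)
        ≈⟨ operator≈kernel (G ⊗ H) f (u , u′) (α , α′) ⟩
      ∑ᵒ[ e ∈ E ×ᶠ E′ ] (∑ᵒ[ β ∈ A ×ᶠ A′ ] (kernel (G ⊗ H) (u , u′) (α , α′) e β * f (right (G ⊗ H) e) β))
        ≈⟨ trans (∑-× E E′ _) (∑-cong E (λ e → ∑-cong E′ (λ e′ → ∑-× A A′ _))) ⟩
      ∑ᵒ[ e ∈ E ] (∑ᵒ[ e′ ∈ E′ ] (∑ᵒ[ β ∈ A ] (∑ᵒ[ β′ ∈ A′ ]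
        (kernel (G ⊗ H) (u , u′) (α , α′) (e , e′) (β , β′) * F e e′ β β′))))
        -- Both indices of `G` have to stand outside those of `H` before `k e β` can be pulled out.
        ≈⟨ ∑-cong E (λ e → ∑-swap E′ A _) ⟩
      ∑ᵒ[ e ∈ E ] (∑ᵒ[ β ∈ A ] (∑ᵒ[ e′ ∈ E′ ] (∑ᵒ[ β′ ∈ A′ ]
        (kernel (G ⊗ H) (u , u′) (α , α′) (e , e′) (β , β′) * F e e′ β β′))))
        ≈⟨ ∑-cong E (λ e → ∑-cong A (λ β → ∑-cong E′ (λ e′ → ∑-cong A′ (λ β′ →
             trans (*-congʳ (kernel-⊗ u u′ α α′ e e′ β β′)) (*-assoc _ _ _))))) ⟩
      ∑ᵒ[ e ∈ E ] (∑ᵒ[ β ∈ A ] (∑ᵒ[ e′ ∈ E′ ] (∑ᵒ[ β′ ∈ A′ ] (k e β * (k′ e′ β′ * F e e′ β β′)))))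
        ≈⟨ ∑-cong E (λ e → ∑-cong A (λ β →
             trans (*-distribˡ-∑ E′ (k e β) _) (∑-cong E′ (λ e′ → *-distribˡ-∑ A′ (k e β) _)))) ⟨
      ∑ᵒ[ e ∈ E ] (∑ᵒ[ β ∈ A ] (k e β * (∑ᵒ[ e′ ∈ E′ ] (∑ᵒ[ β′ ∈ A′ ] (k′ e′ β′ * F e e′ β β′)))))
        ≈⟨ ∑-cong E (λ e → ∑-cong A (λ β → *-congˡ (operator≈kernel H (λ v′ β′ → f (right G e , v′) (β , β′)) u′ α′))) ⟨
      ∑ᵒ[ e ∈ E ] (∑ᵒ[ β ∈ A ] (k e β * operator H (λ v′ β′ → f (right G e , v′) (β , β′)) u′ α′))
        ≈⟨ operator≈kernel G (λ v β → operator H (λ v′ β′ → f (v , v′) (β , β′)) u′ α′) u α ⟨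
      operator G (λ v β → operator H (λ v′ β′ → f (v , v′) (β , β′)) u′ α′) u α ∎
      where
      E = Edge G
      E′ = Edge H
      A = Alphabet G
      A′ = Alphabet H
      k = kernel G u α
      k′ = kernel H u′ α′
      F : Elem E → Elem E′ → Elem A → Elem A′ → ℝ
      F e e′ β β′ = f (right G e , right H e′) (β , β′)

  -- Norms on the product of two games.

  normSq≈∑ : ∀ G g →
    normSq G g ≈ ∑ᵒ[ y ∈ U G ×ᶠ Alphabet G ] (μU G (proj₁ y) * (g (proj₁ y) (proj₂ y) * g (proj₁ y) (proj₂ y)))
  normSq≈∑ G g = trans (normSq-def G g)
    (trans (∑-cong (U G) (λ u → *-distribˡ-∑ (Alphabet G) (μU G u) _)) (sym (∑-× (U G) (Alphabet G) _)))

  normSq-cong : ∀ G {g h} → (∀ u α → g u α ≈ h u α) → normSq G g ≈ normSq G h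
  normSq-cong G {g} {h} p = trans (normSq-def G g)
    (trans (∑-cong (U G) (λ u → *-congˡ (∑-cong (Alphabet G) (λ α → *-cong (p u α) (p u α))))) (sym (normSq-def G h)))

  normSq-* : ∀ G c g → normSq G (λ u α → c * g u α) ≈ (c * c) * normSq G g
  normSq-* G c g = begin
    normSq G (λ u α → c * g u α)
      ≈⟨ normSq≈∑ G (λ u α → c * g u α) ⟩
    ∑ᵒ[ y ∈ Y ] (m y * ((c * g (proj₁ y) (proj₂ y)) * (c * g (proj₁ y) (proj₂ y))))
      ≈⟨ ∑-cong Y (λ y → solve 3 (λ m c x → m :* ((c :* x) :* (c :* x)) := (c :* c) :* (m :* (x :* x))) refl
           (m y) c (g (proj₁ y) (proj₂ y))) ⟩
    ∑ᵒ[ y ∈ Y ] ((c * c) * (m y * (g (proj₁ y) (proj₂ y) * g (proj₁ y) (proj₂ y))))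
      ≈⟨ *-distribˡ-∑ Y (c * c) _ ⟨
    (c * c) * (∑ᵒ[ y ∈ Y ] (m y * (g (proj₁ y) (proj₂ y) * g (proj₁ y) (proj₂ y))))
      ≈⟨ *-congˡ (normSq≈∑ G g) ⟨
    (c * c) * normSq G g ∎
    where
    Y = U G ×ᶠ Alphabet G
    m : Elem Y → ℝ
    m y = μU G (proj₁ y)

  -- Since `μU` factors, `u′` and `α′` can be moved outermost, which leaves the norm of a slice over
  -- `G`. The points `(u′ , α′)` with weight `μU H u′` thus act as a measure space for `G`.
  normSq-⊗ : ∀ G H g → normSq (G ⊗ H) g ≈
    ∑ᵒ[ y ∈ U H ×ᶠ Alphabet H ] (μU H (proj₁ y) * normSq G (λ u α → g (u , proj₁ y) (α , proj₂ y)))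
  normSq-⊗ G H g = begin
    normSq (G ⊗ H) g
      ≈⟨ normSq-def (G ⊗ H) g ⟩
    ∑ᵒ[ u ∈ U G ×ᶠ U H ] (μU (G ⊗ H) u * (∑ᵒ[ α ∈ A ×ᶠ A′ ] (g u α * g u α)))
      ≈⟨ ∑-× (U G) (U H) _ ⟩
    ∑ᵒ[ u ∈ U G ] (∑ᵒ[ u′ ∈ U H ] (μU (G ⊗ H) (u , u′) * (∑ᵒ[ α ∈ A ×ᶠ A′ ] (g (u , u′) α * g (u , u′) α))))
      ≈⟨ ∑-swap (U G) (U H) _ ⟩
    ∑ᵒ[ u′ ∈ U H ] (∑ᵒ[ u ∈ U G ] (μU (G ⊗ H) (u , u′) * (∑ᵒ[ α ∈ A ×ᶠ A′ ] (g (u , u′) α * g (u , u′) α))))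
      ≈⟨ ∑-cong (U H) (λ u′ → ∑-cong (U G) (λ u → *-cong (μU-⊗ G H u u′)
           (trans (∑-× A A′ _) (∑-swap A A′ _)))) ⟩
    ∑ᵒ[ u′ ∈ U H ] (∑ᵒ[ u ∈ U G ] ((μU G u * μU H u′) * (∑ᵒ[ α′ ∈ A′ ] (∑ᵒ[ α ∈ A ] q u u′ α α′))))
      ≈⟨ ∑-cong (U H) (λ u′ → ∑-cong (U G) (λ u → trans (*-distribˡ-∑ A′ _ _)
           (∑-cong A′ (λ α′ → trans (*-congʳ (*-comm _ _)) (*-assoc _ _ _))))) ⟩
    ∑ᵒ[ u′ ∈ U H ] (∑ᵒ[ u ∈ U G ] (∑ᵒ[ α′ ∈ A′ ] (μU H u′ * (μU G u * (∑ᵒ[ α ∈ A ] q u u′ α α′)))))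
      ≈⟨ ∑-cong (U H) (λ u′ → ∑-swap (U G) A′ _) ⟩
    ∑ᵒ[ u′ ∈ U H ] (∑ᵒ[ α′ ∈ A′ ] (∑ᵒ[ u ∈ U G ] (μU H u′ * (μU G u * (∑ᵒ[ α ∈ A ] q u u′ α α′)))))
      ≈⟨ ∑-cong (U H) (λ u′ → ∑-cong A′ (λ α′ →
           trans (*-congˡ (normSq-def G (λ u α → g (u , u′) (α , α′)))) (*-distribˡ-∑ (U G) _ _))) ⟨
    ∑ᵒ[ u′ ∈ U H ] (∑ᵒ[ α′ ∈ A′ ] (μU H u′ * normSq G (λ u α → g (u , u′) (α , α′))))
      ≈⟨ ∑-× (U H) A′ _ ⟨
    ∑ᵒ[ y ∈ U H ×ᶠ A′ ] (μU H (proj₁ y) * normSq G (λ u α → g (u , proj₁ y) (α , proj₂ y))) ∎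
    where
    A = Alphabet G
    A′ = Alphabet H
    q : Elem (U G) → Elem (U H) → Elem A → Elem A′ → ℝ
    q u u′ α α′ = g (u , u′) (α , α′) * g (u , u′) (α , α′)

  -- The slice at `(u′ , α′)` is `g` scaled by the number `h u′ α′`, so `normSq-⊗` leaves the
  -- weighted sum of squares of `h` as a factor.
  normSq-tensor : ∀ G H g h →
    normSq (G ⊗ H) (λ u α → g (proj₁ u) (proj₁ α) * h (proj₂ u) (proj₂ α)) ≈ normSq G g * normSq H h
  normSq-tensor G H g h = begin
    normSq (G ⊗ H) (λ u α → g (proj₁ u) (proj₁ α) * h (proj₂ u) (proj₂ α))
      ≈⟨ normSq-⊗ G H (λ u α → g (proj₁ u) (proj₁ α) * h (proj₂ u) (proj₂ α)) ⟩
    ∑ᵒ[ y ∈ Y ] (m y * normSq G (λ u α → g u α * k y))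
      ≈⟨ ∑-cong Y (λ y → *-congˡ (trans (normSq-cong G (λ u α → *-comm (g u α) (k y))) (normSq-* G (k y) g))) ⟩
    ∑ᵒ[ y ∈ Y ] (m y * ((k y * k y) * normSq G g))
      ≈⟨ ∑-cong Y (λ y → *-assoc (m y) (k y * k y) _) ⟨
    ∑ᵒ[ y ∈ Y ] ((m y * (k y * k y)) * normSq G g)
      ≈⟨ *-distribʳ-∑ Y (normSq G g) _ ⟨
    (∑ᵒ[ y ∈ Y ] (m y * (k y * k y))) * normSq G g
      ≈⟨ *-congʳ (normSq≈∑ H h) ⟨
    normSq H h * normSq G g
      ≈⟨ *-comm _ _ ⟩
    normSq G g * normSq H h ∎
    where
    Y = U H ×ᶠ Alphabet H
    m k : Elem Y → ℝ
    m y = μU H (proj₁ y)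
    k y = h (proj₁ y) (proj₂ y)

  -- After `operator-⊗`, `f v β` is a constant for `H`, and then `operator H g u′ α′` is a constant
  -- for `G`; both come out by linearity.
  operator-⊗-tensor : ∀ G H f g u u′ α α′ →
    operator (G ⊗ H) (λ v β → f (proj₁ v) (proj₁ β) * g (proj₂ v) (proj₂ β)) (u , u′) (α , α′) ≈
    operator G f u α * operator H g u′ α′
  operator-⊗-tensor G H f g u u′ α α′ = begin
    operator (G ⊗ H) (λ v β → f (proj₁ v) (proj₁ β) * g (proj₂ v) (proj₂ β)) (u , u′) (α , α′)
      ≈⟨ operator-⊗ G H (λ v β → f (proj₁ v) (proj₁ β) * g (proj₂ v) (proj₂ β)) u u′ α α′ ⟩
    operator G (λ v β → operator H (λ v′ β′ → f v β * g v′ β′) u′ α′) u α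
      ≈⟨ operator-cong G (λ v β → trans (operator-* H (f v β) g u′ α′) (*-comm (f v β) _)) u α ⟩
    operator G (λ v β → operator H g u′ α′ * f v β) u α
      ≈⟨ operator-* G (operator H g u′ α′) f u α ⟩
    operator H g u′ α′ * operator G f u α
      ≈⟨ *-comm _ _ ⟩
    operator G f u α * operator H g u′ α′ ∎

  -- `val₊` as an inequality between integrals.

  normSq≥0 : ∀ G g → 0# ≤ normSq G g
  normSq≥0 G g = ∑-nonNeg (U G) (λ u → *-nonNeg (proj₁ (μU-pos G u)) (∑-nonNeg (Alphabet G) (λ α → square≥0 (g u α))))

  val₊≥0 : ∀ G → 0# ≤ val₊ G
  val₊≥0 G = proj₁ (proj₂ (val₊-sup G)) 0# (inj₁ refl)

  weightedSpace : (X : FinSet) (w : Elem X → ℝ) → (∀ x → 0# ≤ w x) → MeasureSpace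
  weightedSpace X w w≥0 = record { points = size X ; μ = w ∘ at X ; μ-nonNeg = w≥0 ∘ at X }

  ‖⊗Id‖≤val₊*max : ∀ G Ω f → (∀ v β ω → 0# ≤ f v β ω) → ‖⊗Id‖ G Ω f ≤ val₊ G * max‖T⊗Id‖ G Ω f
  ‖⊗Id‖≤val₊*max G Ω f f≥0 with max‖T⊗Id‖ G Ω f ≈? 0#
  -- A zero denominator gives no ratio, so the supremum says nothing; the crude bound `√ C * D` is 0
  -- here and gives the claim instead.
  ... | yes D≈0 = ≤-respʳ (trans (*-congˡ D≈0) (trans (zeroʳ _) (sym (trans (*-congˡ D≈0) (zeroʳ _))))) (Bound.norm≤ G Ω f f≥0)
  ... | no  D≉0 = ≤-respˡ (/-cancel _ D≉0) (*-monoˡ-≤ (Bound.D≥0 G Ω f f≥0)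
        (proj₁ (proj₂ (val₊-sup G)) _ (inj₂ record { Ω = Ω ; f = f ; f-nonNeg = f≥0 ; nonzero = D≉0 ; value = refl })))

  opaque
    unfolding ∑ᵒ

    -- The form in which `val₊` enters the proof: squared, so that no roots remain; over any
    -- weighted finite set, so that products of finite sets can serve as measure spaces; with a free
    -- bound `M` on the masses in place of the maximum, so that another instance can supply it.
    val₊-bound : ∀ G X (w : Elem X → ℝ) (f : Elem (V G) → Elem (Alphabet G) → Elem X → ℝ) {M} →
      (∀ x → 0# ≤ w x) → (∀ v β x → 0# ≤ f v β x) → 0# ≤ M →
      (∀ v → ∑ᵒ[ x ∈ X ] (w x * ((∑ᵒ[ β ∈ Alphabet G ] f v β x) * (∑ᵒ[ β ∈ Alphabet G ] f v β x))) ≤ M) →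
      ∑ᵒ[ x ∈ X ] (w x * normSq G (operator G (λ v β → f v β x))) ≤ (val₊ G * val₊ G) * M
    val₊-bound G X w f {M} w≥0 f≥0 M≥0 T≤M =
      ≤-trans (≤√² _)
        (≤-trans (square-mono-≤ (√-nonNeg _) (‖⊗Id‖≤val₊*max G Ω f′ (λ v β ω → f≥0 v β (at X ω))))
          (≤-respˡ (sym (square-* (val₊ G) D))
            (*-monoʳ-≤ (square≥0 (val₊ G))
              (≤-trans (square-mono-≤ (maxOver-nonNeg (V G) (‖T⊗Id‖ G Ω f′)) D≤√M) (√²≤ M≥0)))))
      where
      Ω : MeasureSpace
      Ω = weightedSpace X w w≥0
      f′ : Elem (V G) → Elem (Alphabet G) → Fin (size X) → ℝ
      f′ v β ω = f v β (at X ω)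
      D : ℝ
      D = max‖T⊗Id‖ G Ω f′
      D≤√M : D ≤ √ M
      D≤√M = maxOver-lub (V G) (√-nonNeg M) (λ v → √-mono (∫-nonNeg Ω (λ ω → square≥0 (∑ (Alphabet G) (λ β → f′ v β ω)))) (T≤M v))

  -- With the identity enumeration, a sum over `Points Ω` unfolds to the `sum` inside `∫`, so
  -- integrals and sums over finite sets share their lemmas.
  Points : MeasureSpace → FinSet
  Points Ω = record { Elem = Point Ω ; size = points Ω ; enum = ↔-id _ }

  -- Fubini: two nested weighted sums become one over the product measure, the shape that
  -- `val₊-bound` takes.
  ∑-×-weighted : ∀ X Y (a : Elem X → ℝ) (b : Elem Y → ℝ) (h : Elem X → Elem Y → ℝ) →
    ∑ᵒ[ y ∈ Y ] (b y * (∑ᵒ[ x ∈ X ] (a x * h x y))) ≈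
    ∑ᵒ[ p ∈ X ×ᶠ Y ] ((a (proj₁ p) * b (proj₂ p)) * h (proj₁ p) (proj₂ p))
  ∑-×-weighted X Y a b h = begin
    ∑ᵒ[ y ∈ Y ] (b y * (∑ᵒ[ x ∈ X ] (a x * h x y)))
      ≈⟨ ∑-cong Y (λ y → *-distribˡ-∑ X (b y) _) ⟩
    ∑ᵒ[ y ∈ Y ] (∑ᵒ[ x ∈ X ] (b y * (a x * h x y)))
      ≈⟨ ∑-swap Y X _ ⟩
    ∑ᵒ[ x ∈ X ] (∑ᵒ[ y ∈ Y ] (b y * (a x * h x y)))
      ≈⟨ ∑-cong X (λ x → ∑-cong Y (λ y → trans (x*yz≈y*xz (b y) (a x) (h x y)) (sym (*-assoc _ _ _)))) ⟩
    ∑ᵒ[ x ∈ X ] (∑ᵒ[ y ∈ Y ] ((a x * b y) * h x y))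
      ≈⟨ ∑-× X Y _ ⟨
    ∑ᵒ[ p ∈ X ×ᶠ Y ] ((a (proj₁ p) * b (proj₂ p)) * h (proj₁ p) (proj₂ p)) ∎

  ∑-×-tensor : ∀ X Y (a h : Elem X → ℝ) (b k : Elem Y → ℝ) →
    ∑ᵒ[ p ∈ X ×ᶠ Y ] ((a (proj₁ p) * b (proj₂ p)) * (h (proj₁ p) * k (proj₂ p))) ≈
    (∑ᵒ[ x ∈ X ] (a x * h x)) * (∑ᵒ[ y ∈ Y ] (b y * k y))
  ∑-×-tensor X Y a h b k = trans
    (∑-cong (X ×ᶠ Y) (λ p → *-swap-middle (a (proj₁ p)) (b (proj₂ p)) _ _))
    (∑-*-∑ X Y (λ x → a x * h x) (λ y → b y * k y))

  *-mono-≤ : ∀ {w x y z} → 0# ≤ w → 0# ≤ z → w ≤ x → y ≤ z → w * y ≤ x * z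
  *-mono-≤ w≥0 z≥0 p q = ≤-trans (*-monoʳ-≤ w≥0 q) (*-monoˡ-≤ z≥0 p)

  module _ (G : ProjectionGame) (Ω : MeasureSpace) (f : Elem (V G) → Elem (Alphabet G) → Point Ω → ℝ) where

    -- This and `massIntegral` are the quantities under the roots of `‖⊗Id‖` and `‖T⊗Id‖`, written
    -- with `∑ᵒ`.
    normIntegral : ℝ
    normIntegral = ∑ᵒ[ ω ∈ Points Ω ] (μ Ω ω * normSq G (operator G (λ v β → f v β ω)))

    massIntegral : Elem (V G) → ℝ
    massIntegral v = ∑ᵒ[ ω ∈ Points Ω ] (μ Ω ω * ((∑ᵒ[ β ∈ Alphabet G ] f v β ω) * (∑ᵒ[ β ∈ Alphabet G ] f v β ω)))

    opaque
      unfolding ∑ᵒ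

      normIntegral≥0 : 0# ≤ normIntegral
      normIntegral≥0 = ∫-nonNeg Ω (λ ω → normSq≥0 G (operator G (λ v β → f v β ω)))

      massIntegral≥0 : ∀ v → 0# ≤ massIntegral v
      massIntegral≥0 v = ∫-nonNeg Ω (λ ω → square≥0 _)

      ‖⊗Id‖²≈normIntegral : ‖⊗Id‖ G Ω f * ‖⊗Id‖ G Ω f ≈ normIntegral
      ‖⊗Id‖²≈normIntegral = √-square normIntegral≥0

      massIntegral≤max² : ∀ v → massIntegral v ≤ max‖T⊗Id‖ G Ω f * max‖T⊗Id‖ G Ω f
      massIntegral≤max² v = ≤-trans (≤√² _) (square-mono-≤ (√-nonNeg _) (≤maxOver (V G) (‖T⊗Id‖ G Ω f) v))

  -- Upper bound for the product game.

  normIntegral-⊗≤ : ∀ G H Ω f → (∀ v β ω → 0# ≤ f v β ω) → let D = max‖T⊗Id‖ (G ⊗ H) Ω f in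
    normIntegral (G ⊗ H) Ω f ≤ (val₊ G * val₊ G) * ((val₊ H * val₊ H) * (D * D))
  normIntegral-⊗≤ G H Ω f f≥0 = ≤-respˡ (sym split)
    -- The outer instance, for `G`: its test function is `K`, its points are `(u′ , α′)` paired with
    -- `ω`, and its `M` is `(val₊ H * val₊ H) * (D * D)`.
    (val₊-bound G (Y ×ᶠ P) w (λ v β x → K v β (proj₁ x) (proj₂ x))
      (λ x → *-nonNeg (m≥0 (proj₁ x)) (μ-nonNeg Ω (proj₂ x)))
      -- The operator of `H` preserves nonnegativity, so `K` is admissible.
      (λ v β x → Bound.operator≥0 H _ (λ v′ β′ → f≥0 (v , v′) (β , β′) (proj₂ x)) (proj₁ (proj₁ x)) (proj₂ (proj₁ x)))
      (*-nonNeg (square≥0 (val₊ H)) (square≥0 D))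
      -- The mass hypothesis at `v` is the conclusion of an inner instance for `H` over `P` with
      -- test function `F v`; `gather` identifies the two.
      (λ v → ≤-respˡ (gather v) (val₊-bound H P (μ Ω) (F v) (μ-nonNeg Ω)
        (λ v′ β′ ω → ∑ᵒ-nonNeg A (λ β → f≥0 (v , v′) (β , β′) ω)) (square≥0 D)
        -- The mass of `F v` at `v′` is that of `f` at the pair `(v , v′)`, which `D` controls.
        (λ v′ → ≤-respˡ (marginal v v′) (massIntegral≤max² (G ⊗ H) Ω f (v , v′))))))
    where
    P = Points Ω
    A = Alphabet G
    A′ = Alphabet H
    Y = U H ×ᶠ A′
    D = max‖T⊗Id‖ (G ⊗ H) Ω f
    m : Elem Y → ℝ
    m y = μU H (proj₁ y)
    m≥0 : ∀ y → 0# ≤ m y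
    m≥0 y = proj₁ (μU-pos H (proj₁ y))
    w : Elem (Y ×ᶠ P) → ℝ
    w x = m (proj₁ x) * μ Ω (proj₂ x)
    K : Elem (V G) → Elem A → Elem Y → Point Ω → ℝ
    K v β y ω = operator H (λ v′ β′ → f (v , v′) (β , β′) ω) (proj₁ y) (proj₂ y)
    F : Elem (V G) → Elem (V H) → Elem A′ → Point Ω → ℝ
    F v v′ β′ ω = ∑ᵒ[ β ∈ A ] f (v , v′) (β , β′) ω
    split : normIntegral (G ⊗ H) Ω f ≈
      ∑ᵒ[ x ∈ Y ×ᶠ P ] (w x * normSq G (operator G (λ v β → K v β (proj₁ x) (proj₂ x))))
    split = trans
      (∑-cong P (λ ω → *-congˡ (trans (normSq-⊗ G H (operator (G ⊗ H) (λ v β → f v β ω)))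
        (∑-cong Y (λ y → *-congˡ (normSq-cong G (λ u α → operator-⊗ G H (λ v β → f v β ω) u (proj₁ y) α (proj₂ y))))))))
      (∑-×-weighted Y P m (μ Ω) (λ y ω → normSq G (operator G (λ v β → K v β y ω))))
    gather : ∀ v → ∑ᵒ[ ω ∈ P ] (μ Ω ω * normSq H (operator H (λ v′ β′ → F v v′ β′ ω))) ≈
      ∑ᵒ[ x ∈ Y ×ᶠ P ] (w x * ((∑ᵒ[ β ∈ A ] K v β (proj₁ x) (proj₂ x)) * (∑ᵒ[ β ∈ A ] K v β (proj₁ x) (proj₂ x))))
    gather v = trans
      (∑-cong P (λ ω → *-congˡ (trans
        -- By linearity the sum over `β` passes through the operator of `H`.
        (normSq-cong H (λ u′ α′ → operator-∑ H A (λ β v′ β′ → f (v , v′) (β , β′) ω) u′ α′))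
        -- Flattening the norm into a single sum over `Y` makes `(u′ , α′)` part of the measure
        -- space.
        (normSq≈∑ H (λ u′ α′ → ∑ᵒ[ β ∈ A ] K v β (u′ , α′) ω)))))
      (∑-×-weighted Y P m (μ Ω) (λ y ω → (∑ᵒ[ β ∈ A ] K v β y ω) * (∑ᵒ[ β ∈ A ] K v β y ω)))
    marginal : ∀ v v′ → massIntegral (G ⊗ H) Ω f (v , v′) ≈
      ∑ᵒ[ ω ∈ P ] (μ Ω ω * ((∑ᵒ[ β′ ∈ A′ ] F v v′ β′ ω) * (∑ᵒ[ β′ ∈ A′ ] F v v′ β′ ω)))
    marginal v v′ = ∑-cong P (λ ω → *-congˡ (*-cong (sums ω) (sums ω)))
      where
      sums : ∀ ω → ∑ᵒ[ β ∈ A ×ᶠ A′ ] f (v , v′) β ω ≈ ∑ᵒ[ β′ ∈ A′ ] F v v′ β′ ω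
      sums ω = trans (∑-× A A′ (λ β → f (v , v′) β ω)) (∑-swap A A′ (λ β β′ → f (v , v′) (β , β′) ω))

  val₊-⊗≤ : ∀ G H → val₊ (G ⊗ H) ≤ val₊ G * val₊ H
  val₊-⊗≤ G H = proj₂ (proj₂ (val₊-sup (G ⊗ H))) _ bound
    where
    v*v≥0 : 0# ≤ val₊ G * val₊ H
    v*v≥0 = *-nonNeg (val₊≥0 G) (val₊≥0 H)
    bound : UpperBound (Ratio₀ (G ⊗ H)) (val₊ G * val₊ H)
    bound t (inj₁ t≈0) = ≤-respˡ (sym t≈0) v*v≥0
    -- Clearing the positive `D` and comparing squares turns the claim into `normIntegral-⊗≤`.
    bound t (inj₂ r) = ≤-respˡ (sym value) (*-cancelʳ-≤ (D≥0 , nonzero ∘ sym) (≤-respˡ (sym (/-cancel _ nonzero))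
      (square-cancel-≤ (*-nonNeg v*v≥0 D≥0)
        (≤-respˡ (sym (‖⊗Id‖²≈normIntegral (G ⊗ H) Ω f))
          (≤-respʳ (solve 3 (λ a b d → (a :* a) :* ((b :* b) :* (d :* d)) := ((a :* b) :* d) :* ((a :* b) :* d)) refl (val₊ G) (val₊ H) D)
            (normIntegral-⊗≤ G H Ω f f-nonNeg))))))
      where
      open Ratio r
      D = max‖T⊗Id‖ (G ⊗ H) Ω f
      D≥0 = maxOver-nonNeg (V (G ⊗ H)) (‖T⊗Id‖ (G ⊗ H) Ω f)

  -- Lower bound by tensor products, and the passage to suprema.

  normIntegral-*≤ : ∀ G H Ω Ω′ f f′ → (∀ v β ω → 0# ≤ f v β ω) → (∀ v β ω → 0# ≤ f′ v β ω) →
    let D = max‖T⊗Id‖ G Ω f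
        D′ = max‖T⊗Id‖ H Ω′ f′
    in normIntegral G Ω f * normIntegral H Ω′ f′ ≤ (val₊ (G ⊗ H) * val₊ (G ⊗ H)) * ((D * D) * (D′ * D′))
  normIntegral-*≤ G H Ω Ω′ f f′ f≥0 f′≥0 = ≤-respˡ norms
    -- The norm and every mass of `F` factor; bounding the two factors of a mass by their own maxima
    -- gives `M` as `(D * D) * (D′ * D′)`.
    (val₊-bound (G ⊗ H) (P ×ᶠ P′) (λ p → μ Ω (proj₁ p) * μ Ω′ (proj₂ p)) F
      (λ p → *-nonNeg (μ-nonNeg Ω (proj₁ p)) (μ-nonNeg Ω′ (proj₂ p)))
      (λ v β p → *-nonNeg (f≥0 (proj₁ v) (proj₁ β) (proj₁ p)) (f′≥0 (proj₂ v) (proj₂ β) (proj₂ p)))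
      (*-nonNeg (square≥0 D) (square≥0 D′))
      (λ v → ≤-respˡ (sym (masses v)) (*-mono-≤ (massIntegral≥0 G Ω f (proj₁ v)) (square≥0 D′)
        (massIntegral≤max² G Ω f (proj₁ v)) (massIntegral≤max² H Ω′ f′ (proj₂ v)))))
    where
    P = Points Ω
    P′ = Points Ω′
    A = Alphabet G
    A′ = Alphabet H
    D = max‖T⊗Id‖ G Ω f
    D′ = max‖T⊗Id‖ H Ω′ f′
    F : Elem (V (G ⊗ H)) → Elem (A ×ᶠ A′) → Elem (P ×ᶠ P′) → ℝ
    F v β p = f (proj₁ v) (proj₁ β) (proj₁ p) * f′ (proj₂ v) (proj₂ β) (proj₂ p)
    norms :
      ∑ᵒ[ p ∈ P ×ᶠ P′ ] ((μ Ω (proj₁ p) * μ Ω′ (proj₂ p)) * normSq (G ⊗ H) (operator (G ⊗ H) (λ v β → F v β p))) ≈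
      normIntegral G Ω f * normIntegral H Ω′ f′
    norms = trans
      (∑-cong (P ×ᶠ P′) (λ (ω , ω′) → *-congˡ (trans
        (normSq-cong (G ⊗ H) (λ (u , u′) (α , α′) →
          operator-⊗-tensor G H (λ v β → f v β ω) (λ v β → f′ v β ω′) u u′ α α′))
        (normSq-tensor G H (operator G (λ v β → f v β ω)) (operator H (λ v β → f′ v β ω′))))))
      (∑-×-tensor P P′ (μ Ω) (λ ω → normSq G (operator G (λ v β → f v β ω)))
        (μ Ω′) (λ ω′ → normSq H (operator H (λ v β → f′ v β ω′))))
    masses : ∀ v →
      ∑ᵒ[ p ∈ P ×ᶠ P′ ] ((μ Ω (proj₁ p) * μ Ω′ (proj₂ p)) * ((∑ᵒ[ β ∈ A ×ᶠ A′ ] F v β p) * (∑ᵒ[ β ∈ A ×ᶠ A′ ] F v β p))) ≈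
      massIntegral G Ω f (proj₁ v) * massIntegral H Ω′ f′ (proj₂ v)
    masses v = trans
      (∑-cong (P ×ᶠ P′) (λ p → *-congˡ (trans (*-cong (sums p) (sums p)) (square-* _ _))))
      (∑-×-tensor P P′ (μ Ω) (λ ω → S ω * S ω) (μ Ω′) (λ ω′ → S′ ω′ * S′ ω′))
      where
      S : Point Ω → ℝ
      S ω = ∑ᵒ[ β ∈ A ] f (proj₁ v) β ω
      S′ : Point Ω′ → ℝ
      S′ ω′ = ∑ᵒ[ β′ ∈ A′ ] f′ (proj₂ v) β′ ω′
      sums : ∀ p → ∑ᵒ[ β ∈ A ×ᶠ A′ ] F v β p ≈ S (proj₁ p) * S′ (proj₂ p)
      sums p = ∑-*-∑ A A′ (λ β → f (proj₁ v) β (proj₁ p)) (λ β′ → f′ (proj₂ v) β′ (proj₂ p))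

  -- Multiplying by the positive `D * D′` and squaring removes divisions and roots and leaves
  -- `normIntegral-*≤`. If a factor is the adjoined 0, nonnegativity of `val₊` suffices.
  ratio₀-*≤val₊-⊗ : ∀ G H {s t} → Ratio₀ G s → Ratio₀ H t → s * t ≤ val₊ (G ⊗ H)
  ratio₀-*≤val₊-⊗ G H {t = t} (inj₁ s≈0) _ = ≤-respˡ (sym (trans (*-congʳ s≈0) (zeroˡ t))) (val₊≥0 (G ⊗ H))
  ratio₀-*≤val₊-⊗ G H {s} (inj₂ _) (inj₁ t≈0) = ≤-respˡ (sym (trans (*-congˡ t≈0) (zeroʳ s))) (val₊≥0 (G ⊗ H))
  ratio₀-*≤val₊-⊗ G H {s} {t} (inj₂ r) (inj₂ r′) = *-cancelʳ-≤ (*-pos D>0 D′>0)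
    (≤-respˡ (sym st*DD′≈NN′) (square-cancel-≤ (*-nonNeg (val₊≥0 (G ⊗ H)) (*-nonNeg (proj₁ D>0) (proj₁ D′>0)))
      (≤-respˡ (trans (*-cong (sym (‖⊗Id‖²≈normIntegral G Ω f)) (sym (‖⊗Id‖²≈normIntegral H Ω′ f′))) (sym (square-* N N′)))
        (≤-respʳ (trans (*-congˡ (sym (square-* D D′))) (sym (square-* (val₊ (G ⊗ H)) (D * D′))))
          (normIntegral-*≤ G H Ω Ω′ f f′ f≥0 f′≥0)))))
    where
    open Ratio r using (Ω; f) renaming (f-nonNeg to f≥0; nonzero to D≉0; value to s≈N/D)
    open Ratio r′ using () renaming (Ω to Ω′; f to f′; f-nonNeg to f′≥0; nonzero to D′≉0; value to t≈N′/D′)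
    N = ‖⊗Id‖ G Ω f
    N′ = ‖⊗Id‖ H Ω′ f′
    D = max‖T⊗Id‖ G Ω f
    D′ = max‖T⊗Id‖ H Ω′ f′
    D>0 : 0# < D
    D>0 = maxOver-nonNeg (V G) (‖T⊗Id‖ G Ω f) , D≉0 ∘ sym
    D′>0 : 0# < D′
    D′>0 = maxOver-nonNeg (V H) (‖T⊗Id‖ H Ω′ f′) , D′≉0 ∘ sym
    st*DD′≈NN′ : (s * t) * (D * D′) ≈ N * N′
    st*DD′≈NN′ = trans (*-swap-middle s t D D′)
      (*-cong (trans (*-congʳ s≈N/D) (/-cancel N D≉0)) (trans (*-congʳ t≈N′/D′) (/-cancel N′ D′≉0)))

  -- For positive `t`, `K / t` is an upper bound of `P`, hence at least `s`. For `t ≈ 0` there is no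
  -- quotient, and the claim is that `K` is nonnegative.
  sup-*≤ : ∀ {P s t K} → IsSupremum P s → 0# ≤ t → 0# ≤ K → (∀ x → P x → x * t ≤ K) → s * t ≤ K
  sup-*≤ {P} {s} {t} {K} (_ , least) t≥0 K≥0 p with t ≈? 0#
  ... | yes t≈0 = ≤-respˡ (sym (trans (*-congˡ t≈0) (zeroʳ s))) K≥0
  ... | no  t≉0 = ≤-respʳ (/-cancel K t≉0) (*-monoˡ-≤ t≥0 (least (K / t [ t≉0 ])
        (λ x Px → *-cancelʳ-≤ (t≥0 , t≉0 ∘ sym) (≤-respʳ (sym (/-cancel K t≉0)) (p x Px)))))

  ratio₀≥0 : ∀ G {t} → Ratio₀ G t → 0# ≤ t
  ratio₀≥0 G (inj₁ t≈0) = ≤-reflexive (sym t≈0)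
  ratio₀≥0 G (inj₂ r) = ≤-respʳ (sym value)
    (*-nonNeg (√-nonNeg _) (proj₁ (inverse-pos (maxOver-nonNeg (V G) (‖T⊗Id‖ G Ω f)) nonzero)))
    where open Ratio r

  -- The suprema are taken one at a time: over the ratios `s` of `G` with `val₊ H` fixed, then, for
  -- each `s`, over those of `H`. There `s` is the fixed factor, hence `ratio₀≥0`.
  val₊-*≤ : ∀ G H → val₊ G * val₊ H ≤ val₊ (G ⊗ H)
  val₊-*≤ G H = sup-*≤ (proj₂ (val₊-sup G)) (val₊≥0 H) (val₊≥0 (G ⊗ H))
    (λ s r → ≤-respˡ (*-comm (val₊ H) s) (sup-*≤ (proj₂ (val₊-sup H)) (ratio₀≥0 G r) (val₊≥0 (G ⊗ H))
      (λ t r′ → ≤-respˡ (*-comm s t) (ratio₀-*≤val₊-⊗ G H r r′))))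

lemma1p9 : (R : CompleteOrderedField) →
    let open CompleteOrderedField R
        open Games R
    in (G H : ProjectionGame) → val₊ (G ⊗ H) ≈ val₊ G * val₊ H
lemma1p9 R G H = Games.≤-antisym R (val₊-⊗≤ R G H) (val₊-*≤ R G H)
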